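{- Let $n$ be a positive integer with prime factorisation $n=2^{k_0}p_1^{k_1}\cdots p_r^{k_r}$, where $p_1,\dots,p_r$ are distinct odd primes, $k_0\geq 0$ and $k_1,\dots,k_r\geq 1$. Then \[ t_{\mathrm{aff}}(n)=n-\sum_{\substack{0\leq m_i\leq k_i\\ i=0,\ldots,r}}\frac{\varphi(2^{m_0})\varphi(p_1^{m_1})\cdots\varphi(p_r^{m_r})}{\operatorname{lcm}\{\lambda(2^{m_0}),\varphi(p_1^{m_1}),\ldots,\varphi(p_r^{m_r})\}}. \]
   Context: $S(\mathbb{Z}_n)$ is the set of bijections $\mathbb{Z}_n\to\mathbb{Z}_n$. For $\pi\in S(\mathbb{Z}_n)$, $\mathrm{cyc}(\pi)$ is the number of cycles (including fixed points) of $\pi$, $t(\pi)=n-\mathrm{cyc}(\pi)$, $[\pi]=\{x\mapsto \pi(x+b): b\in\mathbb{Z}_n\}$ and $t([\pi])=\min_{\sigma\in[\pi]}t(\sigma)$. A permutation is affine if it has the form $x\mapsto ax+b$ with $a\in\mathbb{Z}_n^\times$, $b\in\mathbb{Z}_n$, and $t_{\mathrm{aff}}(n)=\max\{t([\pi]):\pi\in S(\mathbb{Z}_n)\text{ affine}\}$. $\varphi$ is Euler's totient function ($\varphi(1)=1$), and $\lambda(2^m)$ is the maximum order of an element of $\mathbb{Z}_{2^m}^\times$: $\lambda(2^m)=\varphi(2^m)$ for $m\leq 2$ and $\lambda(2^m)=\varphi(2^m)/2$ for $m\geq 3$. -}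

module Defs where

open import Data.Bool.Properties using () renaming (_≟_ to _≟ᵇ_)
open import Data.Fin.Base using (Fin; toℕ)
open import Data.Fin.Permutation using (Permutation′; permutation; _⟨$⟩ʳ_; _∘ₚ_)
open import Data.Fin.Properties using (_≟_; any?; toℕ<n; toℕ-injective; toℕ-fromℕ<)
open import Data.Fin.Subset using (Subset)
open import Data.Integer.Base using () renaming (+_ to pos)
open import Data.List.Base using (List; []; _∷_; [_]; length; map; filter; foldr; deduplicate; upTo; allFin; cartesianProduct; cartesianProductWith)
open import Data.List.Extrema.Nat using (min; max)
open import Data.Nat.Base using (ℕ; zero; suc; _+_; _*_; _∸_; _^_; _%_; _≤_; NonZero)
open import Data.Nat.Coprimality using (coprime?)
open import Data.Nat.DivMod using (_mod_; %-distribˡ-+; [m+n]%n≡m%n; m<n⇒m%n≡m; m%n%n≡m%n)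
open import Data.Nat.GeneralisedArithmetic using (fold)
open import Data.Nat.LCM using (lcm)
open import Data.Nat.ListAction using (product)
open import Data.Nat.Properties using (+-assoc; +-comm; m+[n∸m]≡n; <⇒≤; m^n≢0)
open import Data.Product.Base using (_×_; _,_; ∃-syntax)
open import Data.Rational.Base using (ℚ; 0ℚ) renaming (_+_ to _+ℚ_; _/_ to _/ℚ_)
open import Data.Vec.Base using (Vec; []; _∷_; tabulate; toList; zipWith)
open import Data.Vec.Properties using (≡-dec)
open import Relation.Binary.PropositionalEquality using (_≡_; cong; sym; trans; module ≡-Reasoning)
open import Relation.Nullary using (Dec; does)

-- ℤₙ is Fin n with arithmetic modulo n.

module _ {n : ℕ} .{{_ : NonZero n}} where

  infixl 6 _+ₙ_
  infixl 7 _*ₙ_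
  infixr 8 _^ₙ_

  _+ₙ_ : Fin n → Fin n → Fin n
  x +ₙ y = (toℕ x + toℕ y) mod n

  _*ₙ_ : Fin n → Fin n → Fin n
  x *ₙ y = (toℕ x * toℕ y) mod n

  1ₙ : Fin n
  1ₙ = 1 mod n

  _^ₙ_ : Fin n → ℕ → Fin n
  a ^ₙ k = fold 1ₙ (a *ₙ_) k

  -ₙ_ : Fin n → Fin n
  -ₙ x = (n ∸ toℕ x) mod n

  IsUnit : Fin n → Set
  IsUnit a = ∃[ a′ ] a *ₙ a′ ≡ 1ₙ

  isUnit? : (a : Fin n) → Dec (IsUnit a)
  isUnit? a = any? (λ a′ → a *ₙ a′ ≟ 1ₙ)

  private
    toℕ-mod : ∀ m → toℕ (m mod n) ≡ m % n
    toℕ-mod m = toℕ-fromℕ< _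

    cancel : ∀ x u v → u + v ≡ n → (((toℕ x + u % n) % n) + v % n) % n ≡ toℕ x
    cancel x u v u+v≡n = begin
      ((X + u % n) % n + v % n) % n           ≡⟨ cong (λ z → (z + v % n) % n) inner ⟩
      ((X + u) % n + v % n) % n               ≡⟨ %-distribˡ-+ (X + u) v n ⟨
      ((X + u) + v) % n                       ≡⟨ cong (_% n) (trans (+-assoc X u v) (cong (X +_) u+v≡n)) ⟩
      (X + n) % n                             ≡⟨ [m+n]%n≡m%n X n ⟩
      X % n                                   ≡⟨ m<n⇒m%n≡m (toℕ<n x) ⟩
      X                                       ∎
      where
      open ≡-Reasoning
      X = toℕ x
      inner : (X + u % n) % n ≡ (X + u) % n
      inner = begin
        (X + u % n) % n           ≡⟨ %-distribˡ-+ X (u % n) n ⟩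
        (X % n + u % n % n) % n   ≡⟨ cong (λ z → (X % n + z) % n) (m%n%n≡m%n u n) ⟩
        (X % n + u % n) % n       ≡⟨ %-distribˡ-+ X u n ⟨
        (X + u) % n               ∎

    b%n : ∀ (b : Fin n) → toℕ b ≡ toℕ b % n
    b%n b = sym (m<n⇒m%n≡m (toℕ<n b))

    +ₙ-− : ∀ b x → (x +ₙ b) +ₙ (-ₙ b) ≡ x
    +ₙ-− b x = toℕ-injective (begin
      toℕ ((x +ₙ b) +ₙ (-ₙ b))                             ≡⟨ toℕ-mod _ ⟩
      (toℕ (x +ₙ b) + toℕ (-ₙ b)) % n                      ≡⟨ cong (λ z → (z + toℕ (-ₙ b)) % n) (toℕ-mod _) ⟩
      ((toℕ x + toℕ b) % n + toℕ (-ₙ b)) % n               ≡⟨ cong (λ z → ((toℕ x + toℕ b) % n + z) % n) (toℕ-mod _) ⟩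
      ((toℕ x + toℕ b) % n + (n ∸ toℕ b) % n) % n          ≡⟨ cong (λ z → ((toℕ x + z) % n + (n ∸ toℕ b) % n) % n) (b%n b) ⟩
      ((toℕ x + toℕ b % n) % n + (n ∸ toℕ b) % n) % n      ≡⟨ cancel x (toℕ b) (n ∸ toℕ b) (m+[n∸m]≡n (<⇒≤ (toℕ<n b))) ⟩
      toℕ x ∎)
      where open ≡-Reasoning

    −-+ₙ : ∀ b x → (x +ₙ (-ₙ b)) +ₙ b ≡ x
    −-+ₙ b x = toℕ-injective (begin
      toℕ ((x +ₙ (-ₙ b)) +ₙ b)                             ≡⟨ toℕ-mod _ ⟩
      (toℕ (x +ₙ (-ₙ b)) + toℕ b) % n                      ≡⟨ cong (λ z → (z + toℕ b) % n) (toℕ-mod _) ⟩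
      ((toℕ x + toℕ (-ₙ b)) % n + toℕ b) % n               ≡⟨ cong (λ z → ((toℕ x + z) % n + toℕ b) % n) (toℕ-mod _) ⟩
      ((toℕ x + (n ∸ toℕ b) % n) % n + toℕ b) % n          ≡⟨ cong (λ z → ((toℕ x + (n ∸ toℕ b) % n) % n + z) % n) (b%n b) ⟩
      ((toℕ x + (n ∸ toℕ b) % n) % n + toℕ b % n) % n      ≡⟨ cancel x (n ∸ toℕ b) (toℕ b) (trans (+-comm (n ∸ toℕ b) (toℕ b)) (m+[n∸m]≡n (<⇒≤ (toℕ<n b)))) ⟩
      toℕ x ∎)
      where open ≡-Reasoning

  translation : Fin n → Permutation′ n
  translation b = permutation (_+ₙ b) (_+ₙ (-ₙ b)) (−-+ₙ b) (+ₙ-− b)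

-- The support of the cycle of π through x.  Cycles have length at most n, so
-- the iterates π⁰x, …, πⁿ⁻¹x exhaust it.
cycleOf : ∀ {n} → Permutation′ n → Fin n → Subset n
cycleOf {n} π x = tabulate λ y → does (any? {n = n} λ k → fold x (π ⟨$⟩ʳ_) (toℕ k) ≟ y)

cyc : ∀ {n} → Permutation′ n → ℕ
cyc {n} π = length (deduplicate (≡-dec _≟ᵇ_) (map (cycleOf π) (allFin n)))

-- Truncation is harmless, as cyc π ≤ n.
t : ∀ {n} → Permutation′ n → ℕ
t {n} π = n ∸ cyc π

-- Composition _∘ₚ_ is diagrammatic: the element for b is x ↦ π(x + b).
class : ∀ {n} .{{_ : NonZero n}} → Permutation′ n → List (Permutation′ n)
class {n} π = map (λ b → translation b ∘ₚ π) (allFin n)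

-- The first argument of min is one more candidate for the minimum; t π is
-- already attained in the class at b = 0.
t[_] : ∀ {n} .{{_ : NonZero n}} → Permutation′ n → ℕ
t[ π ] = min (t π) (map t (class π))

IsAffine : ∀ {n} .{{_ : NonZero n}} → Permutation′ n → Set
IsAffine {n} π = ∃[ a ] ∃[ b ] (IsUnit {n} a × (∀ x → π ⟨$⟩ʳ x ≡ a *ₙ x +ₙ b))

IsMaximum : (ℕ → Set) → ℕ → Set
IsMaximum P v = P v × (∀ w → P w → w ≤ v)

-- v is t_aff(n).
IsTAff : (n : ℕ) .{{_ : NonZero n}} → ℕ → Set
IsTAff n = IsMaximum λ v → ∃[ π ] (IsAffine {n} π × t[ π ] ≡ v)

φ : ℕ → ℕ
φ n = length (filter (λ k → coprime? k n) (map suc (upTo n)))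

-- The least k ≥ 1 with aᵏ = 1.  For a unit this is at most n, so restricting to
-- 1 ≤ k ≤ n with default n gives the order; for non-units the value is junk.
order : ∀ {n} .{{_ : NonZero n}} → Fin n → ℕ
order {n} a = min n (filter (λ k → a ^ₙ k ≟ 1ₙ) (map suc (upTo n)))

maxOrder : (n : ℕ) .{{_ : NonZero n}} → ℕ
maxOrder n = max 0 (map order (filter (isUnit? {n}) (allFin n)))

λ2^ : ℕ → ℕ
λ2^ m = maxOrder (2 ^ m) {{m^n≢0 2 m}}

lcms : List ℕ → ℕ
lcms = foldr lcm 1

∏ : ∀ {r} → Vec ℕ r → ℕ
∏ xs = product (toList xs)

infixl 7 _÷_

-- Quotient in ℚ, with the convention a / 0 = 0.
_÷_ : ℕ → ℕ → ℚ
a ÷ zero  = 0ℚ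
a ÷ suc d = pos a /ℚ suc d

-- All (m₁, …, mᵣ) with 0 ≤ mᵢ ≤ kᵢ.
box : ∀ {r} → Vec ℕ r → List (Vec ℕ r)
box []       = [ [] ]
box (k ∷ ks) = cartesianProductWith _∷_ (upTo (suc k)) (box ks)

φ^ : ∀ {r} → Vec ℕ r → Vec ℕ r → Vec ℕ r
φ^ = zipWith (λ p m → φ (p ^ m))

-- For prime pᵢ the denominator is positive, so the convention for a / 0 plays
-- no role.
term : ∀ {r} → Vec ℕ r → ℕ × Vec ℕ r → ℚ
term ps (m₀ , ms) = (φ (2 ^ m₀) * ∏ (φ^ ps ms)) ÷ lcms (λ2^ m₀ ∷ toList (φ^ ps ms))

sumℚ : List ℚ → ℚ
sumℚ = foldr _+ℚ_ 0ℚ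

cycleSum : ∀ {r} → ℕ → Vec ℕ r → Vec ℕ r → ℚ
cycleSum k₀ ps ks = sumℚ (map (term ps) (cartesianProduct (upTo (suc k₀)) (box ks)))

{-# OPTIONS --safe #-}
module Submission where

-- For π of period N, the number of cycles is N⁻¹ Σ_{k<N} |Fix πᵏ|.  The fixed points of the k-th iterate
-- of x ↦ a x + b solve (aᵏ − 1) x = − b (1 + a + ⋯ + aᵏ⁻¹); there are none of them or as many as for b = 0,
-- so the class of x ↦ a x + b has its maximal number of cycles at x ↦ a x, where there are gcd(aᵏ − 1, n)
-- fixed points.  As gcd(c, pᴷ) = Σ_{m≤K} φ(pᵐ) [pᵐ ∣ c] and gcd(c, ·) is multiplicative, this is
-- Σ_m Π φ(pᵢ^mᵢ) [pᵢ^mᵢ ∣ aᵏ − 1 for all i].  If the lcm L(m) of the exponents of the groups of units modulo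
-- pᵢ^mᵢ divides k, then the bracket holds; the converse is true when a is 3 modulo 2^k₀ and a primitive root
-- modulo every other pᵢ^kᵢ, and then summing over k < N turns the bracket into N / L(m).

open import Defs
open import Data.Bool.Properties using () renaming (_≟_ to _≟ᵇ_)
open import Data.Fin.Base using (Fin; zero; suc; toℕ; fromℕ<)
open import Data.Fin.Permutation using (Permutation′; permutation; _⟨$⟩ʳ_; _⟨$⟩ˡ_; inverseˡ; _∘ₚ_)
open import Data.Fin.Properties using (_≟_; any?; toℕ<n; toℕ-fromℕ<; toℕ-injective; pigeonhole)
open import Data.Integer.Base as ℤ using () renaming (+_ to pos)
import Data.Integer.Properties as ℤ
open import Data.List.Base using (List; []; _∷_; _++_; map; length; filter; tabulate; upTo; allFin; deduplicate; cartesianProduct; cartesianProductWith)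
open import Data.List.Membership.Propositional using (_∈_; lose)
open import Data.List.Membership.Propositional.Properties using (∈-map⁺; ∈-map⁻; ∈-filter⁺; ∈-filter⁻; ∈-upTo⁺; ∈-upTo⁻; ∈-allFin; ∈-deduplicate⁺; ∈-deduplicate⁻; ∈-cartesianProductWith⁺; ∈-cartesianProductWith⁻; ∈-cartesianProduct⁻)
open import Data.List.Properties using (map-upTo; upTo-∷ʳ; length-upTo; length-map; length-tabulate; length-deduplicate)
open import Data.List.Relation.Unary.All as ListAll using ([]; _∷_)
open import Data.List.Relation.Unary.AllPairs using (_∷_)
open import Data.List.Relation.Unary.Any using (here; there)
open import Data.List.Relation.Unary.Unique.DecPropositional.Properties using (deduplicate-!)
open import Data.List.Relation.Unary.Unique.Propositional using () renaming (Unique to ListUnique)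
open import Data.List.Relation.Unary.Unique.Propositional.Properties using (allFin⁺)
open import Data.Nat.Base
open import Data.Nat.Combinatorics using (_C_; nCn≡1; nC1≡n; nCk≡nC[n∸k]; k>n⇒nCk≡0; nCk+nC[k+1]≡[n+1]C[k+1])
open import Data.Nat.Coprimality as Coprimality using (Coprime; coprime?)
open import Data.Nat.Divisibility
open import Data.Nat.DivMod
open import Data.Nat.GCD
open import Data.Nat.GeneralisedArithmetic using (fold)
open import Data.Nat.Induction using (<-rec)
open import Data.Nat.LCM
open import Data.Nat.ListAction using (product)
open import Data.Nat.ListAction.Properties using (∈⇒∣product; product≢0)
open import Data.Nat.Primality
open import Data.Nat.Primality.Factorisation using (factorise)
open import Data.Nat.Properties renaming (_≟_ to _≟ℕ_)
open import Data.Nat.Tactic.RingSolver using (solve-∀)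
open import Data.Product.Base using (_×_; _,_; ∃-syntax; proj₁; proj₂)
open import Data.Rational.Base using (0ℚ; _-_; toℚᵘ) renaming (_+_ to _+ℚ_; -_ to -ℚ_)
import Data.Rational.Properties as ℚ
open import Data.Rational.Unnormalised.Base as ℚᵘ using (mkℚᵘ; *≡*)
import Data.Rational.Unnormalised.Properties as ℚᵘ
open import Data.Sum.Base using (_⊎_; inj₁; inj₂; [_,_]′)
open import Data.Unit.Base using (⊤; tt)
open import Data.Vec.Base as Vec using (Vec; []; _∷_; zipWith; toList; lookup)
open import Data.Vec.Properties using (≡-dec; tabulate-cong; lookup∘tabulate; zipWith-map₁)
open import Data.Vec.Relation.Binary.Pointwise.Inductive using (Pointwise; []; _∷_)
open import Data.Vec.Relation.Unary.All as All using (All; []; _∷_)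
open import Data.Vec.Relation.Unary.AllPairs using ([]; _∷_)
open import Data.Vec.Relation.Unary.Unique.Propositional using (Unique)
open import Function.Base using (_∘_; _$_)
open import Function.Bundles using (mk⇔)
open import Relation.Binary.Bundles using (Setoid)
open import Relation.Binary.PropositionalEquality
open import Relation.Nullary using (Dec; yes; no; does; ¬_; ¬?; contradiction; _×-dec_)
open import Relation.Nullary.Decidable using (map′; does-⇔; dec-true; decidable-stable; from-no)
open import Algebra.Properties.CommutativeMonoid.Sum *-1-commutativeMonoid using () renaming (sum to ∏Fin; sum-permute to ∏Fin-permute)
open import Algebra.Properties.CommutativeSemigroup +-commutativeSemigroup using () renaming (interchange to +-interchange)
open import Algebra.Properties.CommutativeSemigroup *-commutativeSemigroup using () renaming (interchange to *-interchange)
open import Data.List.Extrema ≤-totalOrder using (min≤v⁺; v≤min⁺; min≤xs; min≤⊤; max≤v⁺; v≤max⁺)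

-- Finite sums

-- The sum runs over all divisors of n, so a single multiplier a has to attain the exponent of the
-- unit group modulo every pᵐ with m ≤ k at once. Modulo 2ᵐ the residue 3 does so, whereas 5 ≡ 1
-- (mod 4) would miss the exponent 2 modulo 4. For odd p the existence of a primitive root rests on
-- power sums: Σ_{x<p} xᵐ is divisible by p for m < p - 1, so xᵐ ≡ 1 cannot hold for all units when
-- 0 < m < p - 1. This gives elements of every prime power order dividing p - 1, whose products have
-- order p - 1; a correction modulo p² makes the root sharp modulo all higher powers. Fewer cycles
-- mean larger t, so the upper bound asks that every unit a have at least as many cycles as the
-- extremal one. That is the implication valid for all units; the converse is needed for the
-- extremal multiplier alone. Two devices keep the counting inside ℕ: the multiplier is written
-- `suc d`, so that `d * geo (suc d) k` stands for aᵏ - 1, and all cycle counts are scaled by a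
-- common period N, which is divided out only in ℚ.

∑ : ∀ {A : Set} → List A → (A → ℕ) → ℕ
∑ []       f = 0
∑ (x ∷ xs) f = f x + ∑ xs f

∑-cong-∈ : ∀ {A : Set} {f g : A → ℕ} xs → (∀ {x} → x ∈ xs → f x ≡ g x) → ∑ xs f ≡ ∑ xs g
∑-cong-∈ []       eq = refl
∑-cong-∈ (x ∷ xs) eq = cong₂ _+_ (eq (here refl)) (∑-cong-∈ xs (eq ∘ there))

∑-cong : ∀ {A : Set} {f g : A → ℕ} xs → (∀ x → f x ≡ g x) → ∑ xs f ≡ ∑ xs g
∑-cong xs eq = ∑-cong-∈ xs (λ {x} _ → eq x)

∑-mono : ∀ {A : Set} {f g : A → ℕ} xs → (∀ {x} → x ∈ xs → f x ≤ g x) → ∑ xs f ≤ ∑ xs g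
∑-mono []       le = z≤n
∑-mono (x ∷ xs) le = +-mono-≤ (le (here refl)) (∑-mono xs (le ∘ there))

∑-const : ∀ {A : Set} (xs : List A) c → ∑ xs (λ _ → c) ≡ length xs * c
∑-const []       c = refl
∑-const (x ∷ xs) c = cong (c +_) (∑-const xs c)

∑-zero : ∀ {A : Set} {f : A → ℕ} xs → (∀ {x} → x ∈ xs → f x ≡ 0) → ∑ xs f ≡ 0
∑-zero []       eq = refl
∑-zero (x ∷ xs) eq = cong₂ _+_ (eq (here refl)) (∑-zero xs (eq ∘ there))

∑-+ : ∀ {A : Set} xs (f g : A → ℕ) → ∑ xs (λ x → f x + g x) ≡ ∑ xs f + ∑ xs g
∑-+ []       f g = refl
∑-+ (x ∷ xs) f g = trans (cong (f x + g x +_) (∑-+ xs f g)) (+-interchange (f x) (g x) _ _)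

∑-*ˡ : ∀ {A : Set} xs c (f : A → ℕ) → ∑ xs (λ x → c * f x) ≡ c * ∑ xs f
∑-*ˡ []       c f = sym (*-zeroʳ c)
∑-*ˡ (x ∷ xs) c f = trans (cong (c * f x +_) (∑-*ˡ xs c f)) (sym (*-distribˡ-+ c (f x) _))

∑-*ʳ : ∀ {A : Set} xs c (f : A → ℕ) → ∑ xs (λ x → f x * c) ≡ ∑ xs f * c
∑-*ʳ xs c f = trans (∑-cong xs (λ x → *-comm (f x) c)) (trans (∑-*ˡ xs c f) (*-comm c _))

∑-swap : ∀ {A B : Set} xs ys (f : A → B → ℕ) → ∑ xs (λ x → ∑ ys (f x)) ≡ ∑ ys (λ y → ∑ xs (λ x → f x y))
∑-swap []       ys f = sym (∑-zero ys (λ _ → refl))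
∑-swap (x ∷ xs) ys f = trans (cong (∑ ys (f x) +_) (∑-swap xs ys f)) (sym (∑-+ ys (f x) _))

∑-++ : ∀ {A : Set} xs ys (f : A → ℕ) → ∑ (xs ++ ys) f ≡ ∑ xs f + ∑ ys f
∑-++ []       ys f = refl
∑-++ (x ∷ xs) ys f = trans (cong (f x +_) (∑-++ xs ys f)) (sym (+-assoc (f x) _ _))

∑-map : ∀ {A B : Set} (g : A → B) xs (f : B → ℕ) → ∑ (map g xs) f ≡ ∑ xs (f ∘ g)
∑-map g []       f = refl
∑-map g (x ∷ xs) f = cong (f (g x) +_) (∑-map g xs f)

∑-head : ∀ n (f : ℕ → ℕ) → ∑ (upTo (suc n)) f ≡ f 0 + ∑ (upTo n) (f ∘ suc)
∑-head n f = cong (f 0 +_) (trans (cong (λ xs → ∑ xs f) (sym (map-upTo suc n))) (∑-map suc (upTo n) f))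

∑-last : ∀ n (f : ℕ → ℕ) → ∑ (upTo (suc n)) f ≡ ∑ (upTo n) f + f n
∑-last n f = begin
  ∑ (upTo (suc n)) f         ≡⟨ cong (λ xs → ∑ xs f) (upTo-∷ʳ n) ⟨
  ∑ (upTo n ++ n ∷ []) f     ≡⟨ ∑-++ (upTo n) _ f ⟩
  ∑ (upTo n) f + (f n + 0)   ≡⟨ cong (∑ (upTo n) f +_) (+-identityʳ (f n)) ⟩
  ∑ (upTo n) f + f n         ∎
  where open ≡-Reasoning

∑-split : ∀ m n (f : ℕ → ℕ) → ∑ (upTo (m + n)) f ≡ ∑ (upTo m) f + ∑ (upTo n) (f ∘ (m +_))
∑-split zero    n f = refl
∑-split (suc m) n f = begin
  ∑ (upTo (suc (m + n))) f                                          ≡⟨ ∑-head (m + n) f ⟩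
  f 0 + ∑ (upTo (m + n)) (f ∘ suc)                                  ≡⟨ cong (f 0 +_) (∑-split m n (f ∘ suc)) ⟩
  f 0 + (∑ (upTo m) (f ∘ suc) + ∑ (upTo n) (f ∘ (suc m +_)))        ≡⟨ +-assoc (f 0) _ _ ⟨
  f 0 + ∑ (upTo m) (f ∘ suc) + ∑ (upTo n) (f ∘ (suc m +_))          ≡⟨ cong (_+ ∑ (upTo n) (f ∘ (suc m +_))) (∑-head m f) ⟨
  ∑ (upTo (suc m)) f + ∑ (upTo n) (f ∘ (suc m +_))                  ∎
  where open ≡-Reasoning

-- A shift by one trades the term `f j` for `f (j + N)`, which is equal by periodicity. Splitting a
-- sum of N + 1 terms at its two ends expresses this without subtraction.
∑-shift : ∀ (f : ℕ → ℕ) N → (∀ k → f (k + N) ≡ f k) → ∀ j →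
          ∑ (upTo N) (λ k → f (k + j)) ≡ ∑ (upTo N) f
∑-shift f N per zero    = ∑-cong (upTo N) (λ k → cong f (+-identityʳ k))
∑-shift f N per (suc j) = trans (+-cancelˡ-≡ (f j) _ _ step) (∑-shift f N per j)
  where
  open ≡-Reasoning
  g : ℕ → ℕ
  g k = f (k + j)
  step : f j + ∑ (upTo N) (λ k → f (k + suc j)) ≡ f j + ∑ (upTo N) g
  step = begin
    f j + ∑ (upTo N) (λ k → f (k + suc j))  ≡⟨ cong (f j +_) (∑-cong (upTo N) (λ k → cong f (+-suc k j))) ⟩
    g 0 + ∑ (upTo N) (g ∘ suc)              ≡⟨ ∑-head N g ⟨
    ∑ (upTo (suc N)) g                      ≡⟨ ∑-last N g ⟩
    ∑ (upTo N) g + f (N + j)                ≡⟨ cong (λ z → ∑ (upTo N) g + f z) (+-comm N j) ⟩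
    ∑ (upTo N) g + f (j + N)                ≡⟨ cong (∑ (upTo N) g +_) (per j) ⟩
    ∑ (upTo N) g + f j                      ≡⟨ +-comm _ (f j) ⟩
    f j + ∑ (upTo N) g                      ∎

𝟙 : ∀ {P : Set} → Dec P → ℕ
𝟙 (yes _) = 1
𝟙 (no _)  = 0

𝟙-yes : ∀ {P : Set} (d : Dec P) → P → 𝟙 d ≡ 1
𝟙-yes (yes _) p = refl
𝟙-yes (no ¬p) p = contradiction p ¬p

𝟙-no : ∀ {P : Set} (d : Dec P) → ¬ P → 𝟙 d ≡ 0
𝟙-no (yes p) ¬p = contradiction p ¬p
𝟙-no (no _)  ¬p = refl

𝟙-mono : ∀ {P Q : Set} (d : Dec P) (e : Dec Q) → (P → Q) → 𝟙 d ≤ 𝟙 e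
𝟙-mono (no _)  e f = z≤n
𝟙-mono (yes p) e f = ≤-reflexive (sym (𝟙-yes e (f p)))

𝟙-cong : ∀ {P Q : Set} (d : Dec P) (e : Dec Q) → (P → Q) → (Q → P) → 𝟙 d ≡ 𝟙 e
𝟙-cong d e f g = ≤-antisym (𝟙-mono d e f) (𝟙-mono e d g)

𝟙-× : ∀ {P Q : Set} (d : Dec P) (e : Dec Q) → 𝟙 (d ×-dec e) ≡ 𝟙 d * 𝟙 e
𝟙-× (no _)  e       = refl
𝟙-× (yes _) (yes _) = refl
𝟙-× (yes _) (no _)  = refl

∑-𝟙-unique : ∀ {A : Set} {P : A → Set} (P? : ∀ x → Dec (P x)) {xs : List A} {y : A} →
             ListUnique xs → y ∈ xs → P y → (∀ {x} → P x → y ≡ x) → ∑ xs (𝟙 ∘ P?) ≡ 1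
∑-𝟙-unique P? {x ∷ xs} (x≢ ∷ _) (here refl) Py uniq =
  cong₂ _+_ (𝟙-yes (P? x) Py) (∑-zero xs (λ {z} z∈xs → 𝟙-no (P? z) (ListAll.lookup x≢ z∈xs ∘ uniq)))
∑-𝟙-unique P? {x ∷ xs} (x≢ ∷ u) (there y∈xs) Py uniq =
  cong₂ _+_ (𝟙-no (P? x) (λ Px → ListAll.lookup x≢ y∈xs (sym (uniq Px)))) (∑-𝟙-unique P? u y∈xs Py uniq)

-- Each block of `d` consecutive numbers contributes exactly its first entry.
count-multiples : ∀ q d .{{_ : NonZero d}} → ∑ (upTo (q * d)) (λ k → 𝟙 (d ∣? k)) ≡ q
count-multiples zero    d          = refl
count-multiples (suc q) d@(suc d′) = trans (∑-split d (q * d) f) (cong₂ _+_ first rest)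
  where
  f : ℕ → ℕ
  f k = 𝟙 (d ∣? k)
  first : ∑ (upTo d) f ≡ 1
  first = trans (∑-head d′ f) (cong₂ _+_ (𝟙-yes (d ∣? 0) (d ∣0))
    (∑-zero (upTo d′) λ {k} k∈ → 𝟙-no (d ∣? suc k) λ d∣1+k →
      <⇒≱ (∈-upTo⁻ k∈) (s≤s⁻¹ (∣⇒≤ d∣1+k))))
  rest : ∑ (upTo (q * d)) (λ k → f (d + k)) ≡ q
  rest = trans (∑-cong (upTo (q * d)) λ k →
           𝟙-cong (d ∣? (d + k)) (d ∣? k) (λ h → ∣m+n∣m⇒∣n h ∣-refl) (∣m∣n⇒∣m+n ∣-refl))
         (count-multiples q d)

-- Congruences of natural numbers

infix 4 _≋_[_]

-- Allowing a multiple of the modulus on both sides avoids subtraction.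
record _≋_[_] (a b n : ℕ) : Set where
  constructor congruent
  field
    u v : ℕ
    eq  : a + u * n ≡ b + v * n

module _ {n : ℕ} where

  ≋-reflexive : ∀ {a b} → a ≡ b → a ≋ b [ n ]
  ≋-reflexive eq = congruent 0 0 (cong (_+ 0) eq)

  ≋-refl : ∀ {a} → a ≋ a [ n ]
  ≋-refl = ≋-reflexive refl

  ≋-sym : ∀ {a b} → a ≋ b [ n ] → b ≋ a [ n ]
  ≋-sym (congruent u v eq) = congruent v u (sym eq)

  ≋-trans : ∀ {a b c} → a ≋ b [ n ] → b ≋ c [ n ] → a ≋ c [ n ]
  ≋-trans {a} {b} {c} (congruent u v eq) (congruent u′ v′ eq′) = congruent (u + u′) (v′ + v) (begin
    a + (u + u′) * n      ≡⟨ expand a u u′ n ⟩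
    a + u * n + u′ * n    ≡⟨ cong (_+ u′ * n) eq ⟩
    b + v * n + u′ * n    ≡⟨ swap b v u′ n ⟩
    b + u′ * n + v * n    ≡⟨ cong (_+ v * n) eq′ ⟩
    c + v′ * n + v * n    ≡⟨ expand c v′ v n ⟨
    c + (v′ + v) * n      ∎)
    where
    open ≡-Reasoning
    expand : ∀ x y z n → x + (y + z) * n ≡ x + y * n + z * n
    expand = solve-∀
    swap : ∀ x y z n → x + y * n + z * n ≡ x + z * n + y * n
    swap = solve-∀

  ≋-setoid : Setoid _ _
  ≋-setoid = record
    { Carrier = ℕ ; _≈_ = λ a b → a ≋ b [ n ]
    ; isEquivalence = record { refl = ≋-refl ; sym = ≋-sym ; trans = ≋-trans } }

  ≋-+ : ∀ {a b c d} → a ≋ b [ n ] → c ≋ d [ n ] → a + c ≋ b + d [ n ]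
  ≋-+ {a} {b} {c} {d} (congruent u v eq) (congruent u′ v′ eq′) = congruent (u + u′) (v + v′) (begin
    a + c + (u + u′) * n        ≡⟨ expand a c u u′ n ⟩
    (a + u * n) + (c + u′ * n)  ≡⟨ cong₂ _+_ eq eq′ ⟩
    (b + v * n) + (d + v′ * n)  ≡⟨ expand b d v v′ n ⟨
    b + d + (v + v′) * n        ∎)
    where
    open ≡-Reasoning
    expand : ∀ x y z w n → x + y + (z + w) * n ≡ (x + z * n) + (y + w * n)
    expand = solve-∀

  ≋-* : ∀ {a b c d} → a ≋ b [ n ] → c ≋ d [ n ] → a * c ≋ b * d [ n ]
  ≋-* {a} {b} {c} {d} (congruent u v eq) (congruent u′ v′ eq′) =
    congruent (a * u′ + u * c + u * u′ * n) (b * v′ + v * d + v * v′ * n) (begin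
      a * c + (a * u′ + u * c + u * u′ * n) * n  ≡⟨ expand a c u u′ n ⟩
      (a + u * n) * (c + u′ * n)                 ≡⟨ cong₂ _*_ eq eq′ ⟩
      (b + v * n) * (d + v′ * n)                 ≡⟨ expand b d v v′ n ⟨
      b * d + (b * v′ + v * d + v * v′ * n) * n  ∎)
    where
    open ≡-Reasoning
    expand : ∀ x y z w n → x * y + (x * w + z * y + z * w * n) * n ≡ (x + z * n) * (y + w * n)
    expand = solve-∀

  ≋-^ : ∀ {a b} → a ≋ b [ n ] → ∀ k → a ^ k ≋ b ^ k [ n ]
  ≋-^ eq zero    = ≋-refl
  ≋-^ eq (suc k) = ≋-* eq (≋-^ eq k)

  ≋1-^ : ∀ {a} → a ≋ 1 [ n ] → ∀ k → a ^ k ≋ 1 [ n ]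
  ≋1-^ eq k = ≋-trans (≋-^ eq k) (≋-reflexive (^-zeroˡ k))

  ^≋1-∣ : ∀ {a j k} → a ^ j ≋ 1 [ n ] → j ∣ k → a ^ k ≋ 1 [ n ]
  ^≋1-∣ {a} {j} eq (divides q refl) =
    ≋-trans (≋-reflexive (trans (cong (a ^_) (*-comm q j)) (sym (^-*-assoc a j q)))) (≋1-^ eq q)

  ∣⇒≋0 : ∀ {a} → n ∣ a → a ≋ 0 [ n ]
  ∣⇒≋0 (divides q refl) = congruent 0 q (+-identityʳ _)

  ≋-∣ : ∀ {a b} → a ≋ b [ n ] → n ∣ a → n ∣ b
  ≋-∣ {b = b} (congruent u v eq) n∣a =
    ∣m+n∣n⇒∣m b (subst (n ∣_) eq (∣m∣n⇒∣m+n n∣a (n∣m*n u))) (n∣m*n v)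
    where
    ∣m+n∣n⇒∣m : ∀ m {o} → n ∣ m + o → n ∣ o → n ∣ m
    ∣m+n∣n⇒∣m m {o} h = ∣m+n∣m⇒∣n (subst (n ∣_) (+-comm m o) h)

  ≋0⇒∣ : ∀ {a} → a ≋ 0 [ n ] → n ∣ a
  ≋0⇒∣ eq = ≋-∣ (≋-sym eq) (n ∣0)

  ≋-cancel-+ˡ : ∀ c {a b} → c + a ≋ c + b [ n ] → a ≋ b [ n ]
  ≋-cancel-+ˡ c {a} {b} (congruent u v eq) = congruent u v
    (+-cancelˡ-≡ c _ _ (trans (sym (+-assoc c a _)) (trans eq (+-assoc c b _))))

  ≋1⇒∣ : ∀ {c} → suc c ≋ 1 [ n ] → n ∣ c
  ≋1⇒∣ eq = ≋0⇒∣ (≋-cancel-+ˡ 1 eq)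

  ∣⇒≋1 : ∀ {c} → n ∣ c → suc c ≋ 1 [ n ]
  ∣⇒≋1 n∣c = ≋-+ (≋-refl {1}) (∣⇒≋0 n∣c)

  ≋-weaken : ∀ {m a b} → m ∣ n → a ≋ b [ n ] → a ≋ b [ m ]
  ≋-weaken {m} {a} {b} (divides q n≡qm) (congruent u v eq) = congruent (u * q) (v * q)
    (subst₂ (λ x y → a + x ≡ b + y) (lem u) (lem v) eq)
    where
    lem : ∀ w → w * n ≡ w * q * m
    lem w = trans (cong (w *_) n≡qm) (sym (*-assoc w q m))

  module _ .{{_ : NonZero n}} where

    ≋⇒% : ∀ {a b} → a ≋ b [ n ] → a % n ≡ b % n
    ≋⇒% {a} {b} (congruent u v eq) =
      trans (sym ([m+kn]%n≡m%n a u n)) (trans (cong (_% n) eq) ([m+kn]%n≡m%n b v n))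

    %-≋ : ∀ a → a % n ≋ a [ n ]
    %-≋ a = congruent (a / n) 0 (trans (sym (m≡m%n+[m/n]*n a n)) (sym (+-identityʳ a)))

    %⇒≋ : ∀ {a b} → a % n ≡ b % n → a ≋ b [ n ]
    %⇒≋ {a} {b} eq = ≋-trans (≋-sym (%-≋ a)) (≋-trans (≋-reflexive eq) (%-≋ b))

    ≋? : ∀ a b → Dec (a ≋ b [ n ])
    ≋? a b = map′ %⇒≋ ≋⇒% (a % n ≟ℕ b % n)

module ≋-Reasoning (n : ℕ) where
  open import Relation.Binary.Reasoning.Setoid (≋-setoid {n}) public

≋-mod-1 : ∀ {a b} → a ≋ b [ 1 ]
≋-mod-1 {a} {b} = congruent b a (subst₂ (λ x y → a + x ≡ b + y) (sym (*-identityʳ b)) (sym (*-identityʳ a)) (+-comm a b))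

-- Coprimality and greatest common divisors

coprime-*-∣ : ∀ {m n k} → Coprime m n → m ∣ k → n ∣ k → m * n ∣ k
coprime-*-∣ {m} {n} c (divides q refl) n∣qm =
  subst (_∣ q * m) (*-comm n m) (*-monoˡ-∣ m (Coprimality.coprime-divisor {o = q} (Coprimality.sym c) (subst (n ∣_) (*-comm q m) n∣qm)))

-- For `below`, `d` divides n c and n m, hence n g; as it also divides g c, it divides gcd (g c) (g
-- n) = g h. Coprimality enters only in `above`, through the coprime factors `g` and `h`.
gcd-*-coprime : ∀ c {m n} → Coprime m n → gcd c (m * n) ≡ gcd c m * gcd c n
gcd-*-coprime c {m} {n} cop = ∣-antisym below above
  where
  g = gcd c m
  h = gcd c n
  d = gcd c (m * n)
  above : g * h ∣ d
  above = gcd-greatest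
    (coprime-*-∣ (λ (x∣g , x∣h) → cop (∣-trans x∣g (gcd[m,n]∣n c m) , ∣-trans x∣h (gcd[m,n]∣n c n)))
      (gcd[m,n]∣m c m) (gcd[m,n]∣m c n))
    (*-pres-∣ (gcd[m,n]∣n c m) (gcd[m,n]∣n c n))
  d∣g*n : d ∣ g * n
  d∣g*n = subst (d ∣_) (trans (sym (c*gcd[m,n]≡gcd[cm,cn] n c m)) (*-comm n g))
    (gcd-greatest (∣n⇒∣m*n n (gcd[m,n]∣m c (m * n))) (subst (d ∣_) (*-comm m n) (gcd[m,n]∣n c (m * n))))
  below : d ∣ g * h
  below = subst (d ∣_) (sym (c*gcd[m,n]≡gcd[cm,cn] g c n))
    (gcd-greatest (∣n⇒∣m*n g (gcd[m,n]∣m c (m * n))) d∣g*n)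

prime∤⇒coprime : ∀ {p x} → Prime p → ¬ p ∣ x → Coprime p x
prime∤⇒coprime pp p∤x (d∣p , d∣x) with prime⇒irreducible pp d∣p
... | inj₁ d≡1 = d≡1
... | inj₂ refl = contradiction d∣x p∤x

coprime-*ˡ : ∀ {m n x} → Coprime m x → Coprime n x → Coprime (m * n) x
coprime-*ˡ {m} {n} {x} cm cn {d} (d∣mn , d∣x) = cn (Coprimality.coprime-divisor d⊥m d∣mn , d∣x)
  where
  d⊥m : Coprime d m
  d⊥m (e∣d , e∣m) = cm (e∣m , ∣-trans e∣d d∣x)

coprime-^ˡ : ∀ {m x} → Coprime m x → ∀ k → Coprime (m ^ k) x
coprime-^ˡ         c zero    = Coprimality.1-coprimeTo _
coprime-^ˡ {m} {x} c (suc k) = coprime-*ˡ {m} {m ^ k} {x} c (coprime-^ˡ c k)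

prime∣^⇒∣ : ∀ {p x} → Prime p → ∀ k → p ∣ x ^ k → p ∣ x
prime∣^⇒∣         pp zero    p∣1 = contradiction (∣1⇒≡1 p∣1) λ { refl → ¬prime[1] pp }
prime∣^⇒∣ {p} {x} pp (suc k) h = [ (λ z → z) , prime∣^⇒∣ pp k ]′ (euclidsLemma x (x ^ k) pp h)

-- Counting cycles

module _ {n : ℕ} (π : Permutation′ n) where

  iter : ℕ → Fin n → Fin n
  iter k x = fold x (π ⟨$⟩ʳ_) k

  iter-+ : ∀ j k x → iter (j + k) x ≡ iter j (iter k x)
  iter-+ zero    k x = refl
  iter-+ (suc j) k x = cong (π ⟨$⟩ʳ_) (iter-+ j k x)

  iter-injective : ∀ k {x y} → iter k x ≡ iter k y → x ≡ y
  iter-injective zero    eq = eq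
  iter-injective (suc k) eq = iter-injective k
    (trans (sym (inverseˡ π)) (trans (cong (π ⟨$⟩ˡ_) eq) (inverseˡ π)))

  iter-period : ∀ {d x} → iter d x ≡ x → ∀ q → iter (q * d) x ≡ x
  iter-period         eq zero    = refl
  iter-period {d} {x} eq (suc q) = trans (iter-+ d (q * d) x) (trans (cong (iter d) (iter-period eq q)) eq)

  -- Two of the n + 1 iterates π⁰x, ..., πⁿx coincide, and injectivity cancels the smaller power of
  -- π.
  period≤n : ∀ x → ∃[ d ] (iter (suc d) x ≡ x × suc d ≤ n)
  period≤n x with pigeonhole (n<1+n n) (λ i → iter (toℕ i) x)
  ... | i , j , i<j , eq with toℕ j ∸ toℕ i | m+[n∸m]≡n (<⇒≤ i<j) | m∸n≤m (toℕ j) (toℕ i)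
  ... | zero  | i+d≡j | _   = contradiction (trans (sym (+-identityʳ _)) i+d≡j) (<⇒≢ i<j)
  ... | suc d | i+d≡j | d≤j = d , sym returns , ≤-trans d≤j (s≤s⁻¹ (toℕ<n j))
    where
    returns : x ≡ iter (suc d) x
    returns = iter-injective (toℕ i) (trans eq (trans (cong (λ k → iter k x) (sym i+d≡j)) (iter-+ (toℕ i) (suc d) x)))

  -- Reducing `k` modulo the return time of `x` shows that the search over `Fin n` in `cycleOf` sees
  -- the whole orbit.
  iter-bounded : ∀ x k → ∃[ i ] iter (toℕ {n} i) x ≡ iter k x
  iter-bounded x k with period≤n x
  ... | d , eq , d<n = fromℕ< k%<n , (begin
    iter (toℕ (fromℕ< k%<n)) x                            ≡⟨ cong (λ j → iter j x) (toℕ-fromℕ< k%<n) ⟩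
    iter (k % suc d) x                                    ≡⟨ cong (iter (k % suc d)) (iter-period eq (k / suc d)) ⟨
    iter (k % suc d) (iter (k / suc d * suc d) x)         ≡⟨ iter-+ (k % suc d) _ x ⟨
    iter (k % suc d + k / suc d * suc d) x                ≡⟨ cong (λ j → iter j x) (m≡m%n+[m/n]*n k (suc d)) ⟨
    iter k x                                              ∎)
    where
    open ≡-Reasoning
    k%<n : k % suc d < n
    k%<n = ≤-trans (m%n<n k (suc d)) d<n

  private
    reach? : ∀ x y → Dec (∃[ k ] iter (toℕ {n} k) x ≡ y)
    reach? x y = any? λ k → iter (toℕ k) x ≟ y

  cycleOf-iter : ∀ y k → cycleOf π (iter k y) ≡ cycleOf π y
  cycleOf-iter y k = tabulate-cong λ z → does-⇔ (mk⇔ (fwd z) (bwd z)) (reach? (iter k y) z) (reach? y z)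
    where
    fwd : ∀ z → ∃[ i ] iter (toℕ {n} i) (iter k y) ≡ z → ∃[ i ] iter (toℕ {n} i) y ≡ z
    fwd z (i , refl) with iter-bounded y (toℕ i + k)
    ... | j , eq = j , trans eq (iter-+ (toℕ i) k y)
    bwd : ∀ z → ∃[ i ] iter (toℕ {n} i) y ≡ z → ∃[ i ] iter (toℕ {n} i) (iter k y) ≡ z
    bwd z (i , refl) with period≤n y
    -- Going back `k` steps is the same as going on for `k * d` steps, since k + k d is a multiple
    -- of the return time `suc d`.
    ... | d , eq , _ with iter-bounded (iter k y) (toℕ i + k * d)
    ... | j , eq′ = j , (begin
      iter (toℕ j) (iter k y)               ≡⟨ eq′ ⟩
      iter (toℕ i + k * d) (iter k y)       ≡⟨ iter-+ (toℕ i + k * d) k y ⟨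
      iter (toℕ i + k * d + k) y            ≡⟨ cong (λ l → iter l y) rearrange ⟩
      iter (toℕ i + k * suc d) y            ≡⟨ iter-+ (toℕ i) (k * suc d) y ⟩
      iter (toℕ i) (iter (k * suc d) y)     ≡⟨ cong (iter (toℕ i)) (iter-period eq k) ⟩
      iter (toℕ i) y                        ∎)
      where
      open ≡-Reasoning
      rearrange : toℕ i + k * d + k ≡ toℕ i + k * suc d
      rearrange = trans (+-assoc (toℕ i) (k * d) k) (cong (toℕ i +_) (trans (+-comm (k * d) k) (sym (*-suc k d))))

  -- The entry at `x` of `cycleOf π x` is true, by zero steps; hence so is the entry at `x` of
  -- `cycleOf π y`.
  cycleOf-≡⇒iter : ∀ {x y} → cycleOf π x ≡ cycleOf π y → ∃[ k ] iter k y ≡ x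
  cycleOf-≡⇒iter {x} {y} eq with reach? y x | sym (trans (lookup≡ x) (trans (cong (λ c → lookup c x) eq) (sym (lookup≡ y))))
    where
    lookup≡ : ∀ z → does (reach? z x) ≡ lookup (cycleOf π z) x
    lookup≡ z = sym (lookup∘tabulate (λ w → does (reach? z w)) x)
  ... | yes (k , h) | _   = toℕ k , h
  ... | no _        | bad with trans bad (dec-true (reach? x x) (iter-bounded x 0))
  ... | ()

  -- Both sides count the pairs (k , x) with πᵏ x = x; each cycle contributes N.
  burnside : ∀ N → (∀ x → iter N x ≡ x) →
             N * cyc π ≡ ∑ (allFin n) (λ x → ∑ (upTo N) (λ k → 𝟙 (iter k x ≟ x)))
  burnside N per = sym (begin
    ∑ xs W                                            ≡⟨ ∑-cong xs (λ x → sym (trans (∑-*ʳ bs (W x) (λ b → 𝟙 (f x ≟ₛ b))) (trans (cong (_* W x) (one x)) (*-identityˡ (W x))))) ⟩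
    ∑ xs (λ x → ∑ bs (λ b → 𝟙 (f x ≟ₛ b) * W x))      ≡⟨ ∑-swap xs bs _ ⟩
    ∑ bs (λ b → ∑ xs (λ x → 𝟙 (f x ≟ₛ b) * W x))      ≡⟨ ∑-cong-∈ bs fibre ⟩
    ∑ bs (λ _ → N)                                    ≡⟨ ∑-const bs N ⟩
    length bs * N                                     ≡⟨ *-comm (length bs) N ⟩
    N * cyc π                                         ∎)
    where
    open ≡-Reasoning
    f = cycleOf π
    xs = allFin n
    _≟ₛ_ = ≡-dec {n = n} _≟ᵇ_
    bs = deduplicate _≟ₛ_ (map f xs)
    W : Fin n → ℕ
    W x = ∑ (upTo N) (λ k → 𝟙 (iter k x ≟ x))
    one : ∀ x → ∑ bs (λ b → 𝟙 (f x ≟ₛ b)) ≡ 1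
    one x = ∑-𝟙-unique (f x ≟ₛ_) (deduplicate-! _≟ₛ_ (map f xs)) (∈-deduplicate⁺ _≟ₛ_ (∈-map⁺ f (∈-allFin x))) refl (λ eq → eq)
    -- A point x = πʲ y returns to itself as often within N steps as the orbit of `y` visits it: the
    -- two counts differ by the shift `j` of a function with period N. In this form each step `k` of
    -- the orbit of `y` hits exactly one `x`.
    visits : ∀ x y → 𝟙 (f x ≟ₛ f y) * W x ≡ ∑ (upTo N) (λ k → 𝟙 (iter k y ≟ x))
    visits x y with f x ≟ₛ f y
    ... | no fx≢fy = sym (∑-zero (upTo N) λ {k} _ → 𝟙-no (iter k y ≟ x) λ { refl → fx≢fy (cycleOf-iter y k) })
    ... | yes fx≡fy with cycleOf-≡⇒iter fx≡fy
    ... | j , refl = begin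
      W x + 0                                        ≡⟨ +-identityʳ (W x) ⟩
      ∑ (upTo N) (λ k → 𝟙 (iter k x ≟ x))            ≡⟨ ∑-cong (upTo N) (λ k → cong (λ z → 𝟙 (z ≟ x)) (sym (iter-+ k j y))) ⟩
      ∑ (upTo N) (λ k → 𝟙 (iter (k + j) y ≟ x))      ≡⟨ ∑-shift (λ k → 𝟙 (iter k y ≟ x)) N (λ k → cong (λ z → 𝟙 (z ≟ x)) (trans (iter-+ k N y) (cong (iter k) (per y)))) j ⟩
      ∑ (upTo N) (λ k → 𝟙 (iter k y ≟ x))            ∎
    fibre : ∀ {b} → b ∈ bs → ∑ xs (λ x → 𝟙 (f x ≟ₛ b) * W x) ≡ N
    fibre b∈bs with ∈-map⁻ f (∈-deduplicate⁻ _≟ₛ_ (map f xs) b∈bs)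
    ... | y , _ , refl = begin
      ∑ xs (λ x → 𝟙 (f x ≟ₛ f y) * W x)                       ≡⟨ ∑-cong xs (λ x → visits x y) ⟩
      ∑ xs (λ x → ∑ (upTo N) (λ k → 𝟙 (iter k y ≟ x)))        ≡⟨ ∑-swap xs (upTo N) _ ⟩
      ∑ (upTo N) (λ k → ∑ xs (λ x → 𝟙 (iter k y ≟ x)))        ≡⟨ ∑-cong (upTo N) (λ k → ∑-𝟙-unique (iter k y ≟_) (allFin⁺ n) (∈-allFin (iter k y)) refl (λ eq → eq)) ⟩
      ∑ (upTo N) (λ _ → 1)                                    ≡⟨ ∑-const (upTo N) 1 ⟩
      length (upTo N) * 1                                     ≡⟨ trans (*-identityʳ _) (length-upTo N) ⟩
      N                                                       ∎

-- Affine permutations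

∑-tabulate : ∀ {A : Set} {n} (g : Fin n → A) (f : A → ℕ) (h : ℕ → ℕ) → (∀ i → f (g i) ≡ h (toℕ i)) →
             ∑ (tabulate g) f ≡ ∑ (upTo n) h
∑-tabulate {n = zero}  g f h eq = refl
∑-tabulate {n = suc n} g f h eq = trans
  (cong₂ _+_ (eq zero) (∑-tabulate (g ∘ suc) f (h ∘ suc) (eq ∘ suc))) (sym (∑-head n h))

geo : ℕ → ℕ → ℕ
geo a zero    = 0
geo a (suc k) = 1 + a * geo a k

-- With a = `suc d`, this makes `d * geo (suc d) k` the stand-in for aᵏ - 1.
^≡1+geo : ∀ d k → suc d ^ k ≡ suc (d * geo (suc d) k)
^≡1+geo d zero    = cong suc (sym (*-zeroʳ d))
^≡1+geo d (suc k) = trans (cong (suc d *_) (^≡1+geo d k)) (lem d (geo (suc d) k))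
  where
  lem : ∀ d g → suc d * suc (d * g) ≡ suc (d * (1 + suc d * g))
  lem = solve-∀

geo-+ : ∀ a i j → geo a (i + j) ≡ geo a i + a ^ i * geo a j
geo-+ a zero    j = sym (+-identityʳ _)
geo-+ a (suc i) j = trans (cong (λ z → 1 + a * z) (geo-+ a i j)) (lem a (geo a i) (a ^ i) (geo a j))
  where
  lem : ∀ a g b h → 1 + a * (g + b * h) ≡ 1 + a * g + a * b * h
  lem = solve-∀

-- Successive blocks of `M` terms are congruent because aᴹ ≡ 1. For q = n the sum vanishes modulo
-- `n`, which is the origin of the period `n * M` of an affine map.
geo-period : ∀ {n a M} → a ^ M ≋ 1 [ n ] → ∀ q → geo a (q * M) ≋ q * geo a M [ n ]
geo-period             h zero    = ≋-refl
geo-period {n} {a} {M} h (suc q) = begin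
  geo a (M + q * M)                  ≡⟨ geo-+ a M (q * M) ⟩
  geo a M + a ^ M * geo a (q * M)    ≈⟨ ≋-+ ≋-refl (≋-* h (geo-period h q)) ⟩
  geo a M + 1 * (q * geo a M)        ≡⟨ cong (geo a M +_) (*-identityˡ _) ⟩
  geo a M + q * geo a M              ∎
  where open ≋-Reasoning n

module _ {n : ℕ} .{{_ : NonZero n}} where

  solutions-≤ : ∀ c e → ∑ (upTo n) (λ x → 𝟙 (n ∣? (c * x + e))) ≤ ∑ (upTo n) (λ x → 𝟙 (n ∣? (c * x)))
  solutions-≤ c e with anyUpTo? (λ x → n ∣? (c * x + e)) n
  ... | no none = ≤-trans (≤-reflexive (∑-zero (upTo n) λ {x} x∈ →
                    𝟙-no (n ∣? (c * x + e)) λ h → none (x , ∈-upTo⁻ x∈ , h))) z≤n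
  -- Translation by the solution `x₀` turns the equation into the homogeneous one and leaves the sum
  -- over a full period unchanged.
  ... | yes (x₀ , _ , h₀) = ≤-reflexive (begin
    ∑ (upTo n) f                           ≡⟨ ∑-shift f n periodic x₀ ⟨
    ∑ (upTo n) (λ x → f (x + x₀))          ≡⟨ ∑-cong (upTo n) (λ x → 𝟙-cong (n ∣? (c * (x + x₀) + e)) (n ∣? (c * x))
                                                (λ h → ∣m+n∣m⇒∣n (subst (n ∣_) (lem c x x₀ e) h) h₀)
                                                (λ h → subst (n ∣_) (sym (lem c x x₀ e)) (∣m∣n⇒∣m+n h₀ h))) ⟩
    ∑ (upTo n) (λ x → 𝟙 (n ∣? (c * x)))    ∎)
    where
    open ≡-Reasoning
    f : ℕ → ℕ
    f x = 𝟙 (n ∣? (c * x + e))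
    lem : ∀ c x y e → c * (x + y) + e ≡ c * y + e + c * x
    lem = solve-∀
    lem′ : ∀ c x n e → c * (x + n) + e ≡ c * n + (c * x + e)
    lem′ = solve-∀
    periodic : ∀ x → f (x + n) ≡ f x
    periodic x = 𝟙-cong (n ∣? (c * (x + n) + e)) (n ∣? (c * x + e))
      (λ h → ∣m+n∣m⇒∣n (subst (n ∣_) (lem′ c x n e) h) (n∣m*n c))
      (λ h → subst (n ∣_) (sym (lem′ c x n e)) (∣m∣n⇒∣m+n (n∣m*n c) h))

  -- With g = gcd c n and q = n / g, the number c / g is coprime to q, so n ∣ c x amounts to q ∣ x;
  -- there are g multiples of q below n = g q.
  solutions-gcd : ∀ c → ∑ (upTo n) (λ x → 𝟙 (n ∣? (c * x))) ≡ gcd c n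
  solutions-gcd c = begin
    ∑ (upTo n) (λ x → 𝟙 (n ∣? (c * x)))    ≡⟨ ∑-cong (upTo n) (λ x → 𝟙-cong (n ∣? (c * x)) (q ∣? x) (to x) (from x)) ⟩
    ∑ (upTo n) (λ x → 𝟙 (q ∣? x))          ≡⟨ cong (λ z → ∑ (upTo z) (λ x → 𝟙 (q ∣? x))) (trans (*-comm g q) q*g≡n) ⟨
    ∑ (upTo (g * q)) (λ x → 𝟙 (q ∣? x))    ≡⟨ count-multiples g q ⟩
    g                                      ∎
    where
    open ≡-Reasoning
    g = gcd c n
    instance
      g≢0 : NonZero g
      g≢0 = ≢-nonZero (λ g≡0 → ≢-nonZero⁻¹ n (gcd[m,n]≡0⇒n≡0 c g≡0))
    q = n / g
    c′ = c / g
    q*g≡n : q * g ≡ n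
    q*g≡n = m/n*n≡m (gcd[m,n]∣n c n)
    c′*g≡c : c′ * g ≡ c
    c′*g≡c = m/n*n≡m (gcd[m,n]∣m c n)
    instance
      q≢0 : NonZero q
      q≢0 = ≢-nonZero (λ q≡0 → ≢-nonZero⁻¹ n (trans (sym q*g≡n) (cong (_* g) q≡0)))
    cx : ∀ x → c * x ≡ (c′ * x) * g
    cx x = trans (cong (_* x) (sym c′*g≡c)) (lem c′ g x)
      where
      lem : ∀ c g x → c * g * x ≡ c * x * g
      lem = solve-∀
    to : ∀ x → n ∣ c * x → q ∣ x
    to x h = Coprimality.coprime-divisor {n = c′} (Coprimality.sym (Coprimality.coprime-/gcd c n))
      (*-cancelʳ-∣ g (subst₂ _∣_ (sym q*g≡n) (cx x) h))
    from : ∀ x → q ∣ x → n ∣ c * x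
    from x h = subst₂ _∣_ q*g≡n (sym (cx x)) (*-monoˡ-∣ g (∣n⇒∣m*n c′ h))

  toℕ-mod-≋ : ∀ m → toℕ (m mod n) ≋ m [ n ]
  toℕ-mod-≋ m = ≋-trans (≋-reflexive (toℕ-fromℕ< _)) (%-≋ m)

  toℕ-≋-injective : ∀ {x y : Fin n} → toℕ x ≋ toℕ y [ n ] → x ≡ y
  toℕ-≋-injective {x} {y} eq = toℕ-injective
    (trans (sym (m<n⇒m%n≡m (toℕ<n x))) (trans (≋⇒% eq) (m<n⇒m%n≡m (toℕ<n y))))

  module _ (π : Permutation′ n) (d b M : ℕ)
           (affine : ∀ x → toℕ (π ⟨$⟩ʳ x) ≋ suc d * toℕ x + b [ n ])
           (unit : suc d ^ M ≋ 1 [ n ]) where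
    private
      a N : ℕ
      a = suc d
      N = n * M

      -- The displacement πᵏ x - x = (aᵏ - 1) x + b (1 + a + ⋯ + aᵏ⁻¹), whose divisibility by `n`
      -- characterises fixed points of πᵏ.
      drift : ℕ → ℕ → ℕ
      drift k x = d * geo a k * x + b * geo a k

    iter-affine : ∀ k x → toℕ (iter π k x) ≋ toℕ x + drift k (toℕ x) [ n ]
    iter-affine zero    x = ≋-reflexive (sym (lem d (toℕ x) b))
      where
      lem : ∀ d x b → x + (d * 0 * x + b * 0) ≡ x
      lem = solve-∀
    iter-affine (suc k) x = begin
      toℕ (iter π (suc k) x)                ≈⟨ affine (iter π k x) ⟩
      a * toℕ (iter π k x) + b              ≈⟨ ≋-+ (≋-* (≋-refl {a = a}) (iter-affine k x)) ≋-refl ⟩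
      a * (toℕ x + drift k (toℕ x)) + b     ≡⟨ lem d (toℕ x) b (geo a k) ⟩
      toℕ x + drift (suc k) (toℕ x)         ∎
      where
      open ≋-Reasoning n
      lem : ∀ d x b g → suc d * (x + (d * g * x + b * g)) + b ≡ x + (d * (1 + suc d * g) * x + b * (1 + suc d * g))
      lem = solve-∀

    fixed⇒∣ : ∀ k x → iter π k x ≡ x → n ∣ drift k (toℕ x)
    fixed⇒∣ k x eq = ≋0⇒∣ (≋-cancel-+ˡ (toℕ x) (≋-trans (≋-sym (iter-affine k x))
      (≋-reflexive (trans (cong toℕ eq) (sym (+-identityʳ (toℕ x)))))))

    ∣⇒fixed : ∀ k x → n ∣ drift k (toℕ x) → iter π k x ≡ x
    ∣⇒fixed k x h = toℕ-≋-injective (≋-trans (iter-affine k x)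
      (≋-trans (≋-+ ≋-refl (∣⇒≋0 h)) (≋-reflexive (+-identityʳ (toℕ x)))))

    affine-period : ∀ x → iter π N x ≡ x
    affine-period x = ∣⇒fixed N x (∣m∣n⇒∣m+n (∣m⇒∣m*n (toℕ x) (∣n⇒∣m*n d n∣geo)) (∣n⇒∣m*n b n∣geo))
      where
      n∣geo : n ∣ geo a N
      n∣geo = ≋-∣ (≋-sym (geo-period {n} {a} {M} unit n)) (m∣m*n (geo a M))

    cyc-affine : N * cyc π ≡ ∑ (upTo N) (λ k → ∑ (upTo n) (λ x → 𝟙 (n ∣? drift k x)))
    cyc-affine = begin
      N * cyc π                                                      ≡⟨ burnside π N affine-period ⟩
      ∑ (allFin n) (λ x → ∑ (upTo N) (λ k → 𝟙 (iter π k x ≟ x)))     ≡⟨ ∑-swap (allFin n) (upTo N) _ ⟩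
      ∑ (upTo N) (λ k → ∑ (allFin n) (λ x → 𝟙 (iter π k x ≟ x)))     ≡⟨ ∑-cong (upTo N) (λ k → ∑-tabulate (λ x → x) _ (λ x → 𝟙 (n ∣? drift k x))
                                                                          λ x → 𝟙-cong (iter π k x ≟ x) (n ∣? drift k (toℕ x)) (fixed⇒∣ k x) (∣⇒fixed k x)) ⟩
      ∑ (upTo N) (λ k → ∑ (upTo n) (λ x → 𝟙 (n ∣? drift k x)))       ∎
      where open ≡-Reasoning

    cyc-affine-≤ : N * cyc π ≤ ∑ (upTo N) (λ k → gcd (d * geo a k) n)
    cyc-affine-≤ = ≤-trans (≤-reflexive cyc-affine) (∑-mono (upTo N) λ {k} _ →
      ≤-trans (solutions-≤ (d * geo a k) (b * geo a k)) (≤-reflexive (solutions-gcd (d * geo a k))))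

  cyc-linear : ∀ (π : Permutation′ n) d M → (∀ x → toℕ (π ⟨$⟩ʳ x) ≋ suc d * toℕ x [ n ]) →
               suc d ^ M ≋ 1 [ n ] → n * M * cyc π ≡ ∑ (upTo (n * M)) (λ k → gcd (d * geo (suc d) k) n)
  cyc-linear π d M linear unit = trans
    (cyc-affine π d 0 M (λ x → ≋-trans (linear x) (≋-reflexive (sym (+-identityʳ _)))) unit)
    (∑-cong (upTo (n * M)) λ k → trans
      (∑-cong (upTo n) λ x → cong (λ z → 𝟙 (n ∣? z)) (+-identityʳ (d * geo (suc d) k * x)))
      (solutions-gcd (d * geo (suc d) k)))

-- Prime powers

^-mono-∣ : ∀ p {m n} → m ≤ n → p ^ m ∣ p ^ n
^-mono-∣ p {m} {n} m≤n = divides (p ^ (n ∸ m)) (trans (cong (p ^_) (sym (m∸n+n≡m m≤n))) (^-distribˡ-+-* p (n ∸ m) m))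

length-filter-∑ : ∀ {A : Set} {P : A → Set} (P? : ∀ x → Dec (P x)) xs → length (filter P? xs) ≡ ∑ xs (𝟙 ∘ P?)
length-filter-∑ P? []       = refl
length-filter-∑ P? (x ∷ xs) with P? x
... | yes _ = cong suc (length-filter-∑ P? xs)
... | no  _ = length-filter-∑ P? xs

coprime-^ʳ⇒∤ : ∀ {p x} → Prime p → ∀ m → Coprime x (p ^ suc m) → ¬ p ∣ x
coprime-^ʳ⇒∤ {p} pp m cop p∣x = contradiction (cop (p∣x , m∣m*n (p ^ m))) λ { refl → ¬prime[1] pp }

-- Each of 1, ..., pᵐ⁺¹ is either coprime to p or a multiple of p. The multiples are counted over 0,
-- ..., pᵐ⁺¹ - 1 instead, after a shift by one.
φ-prime-power : ∀ {p} → Prime p → ∀ m → φ (p ^ suc m) + p ^ m ≡ p ^ suc m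
φ-prime-power {p} pp m = begin
  φ (p ^ suc m) + p ^ m                                                ≡⟨ cong₂ _+_ φ≡ (sym multiples) ⟩
  ∑ (upTo (p ^ suc m)) unit + ∑ (upTo (p ^ suc m)) (multiple ∘ suc)    ≡⟨ ∑-+ (upTo (p ^ suc m)) unit (multiple ∘ suc) ⟨
  ∑ (upTo (p ^ suc m)) (λ k → unit k + multiple (suc k))               ≡⟨ ∑-cong (upTo (p ^ suc m)) one ⟩
  ∑ (upTo (p ^ suc m)) (λ _ → 1)                                       ≡⟨ ∑-const (upTo (p ^ suc m)) 1 ⟩
  length (upTo (p ^ suc m)) * 1                                        ≡⟨ trans (*-identityʳ _) (length-upTo _) ⟩
  p ^ suc m                                                            ∎
  where
  open ≡-Reasoning
  instance
    p≢0 : NonZero p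
    p≢0 = prime⇒nonZero pp
  unit multiple : ℕ → ℕ
  unit k = 𝟙 (coprime? (suc k) (p ^ suc m))
  multiple k = 𝟙 (p ∣? k)
  φ≡ : φ (p ^ suc m) ≡ ∑ (upTo (p ^ suc m)) unit
  φ≡ = trans (length-filter-∑ (λ k → coprime? k (p ^ suc m)) (map suc (upTo (p ^ suc m)))) (∑-map suc (upTo (p ^ suc m)) _)
  multiples : ∑ (upTo (p ^ suc m)) (multiple ∘ suc) ≡ p ^ m
  multiples = begin
    ∑ (upTo (p ^ suc m)) (multiple ∘ suc)          ≡⟨ ∑-cong (upTo (p ^ suc m)) (λ k → cong multiple (+-comm 1 k)) ⟩
    ∑ (upTo (p ^ suc m)) (λ k → multiple (k + 1))  ≡⟨ ∑-shift multiple (p ^ suc m) (λ k → 𝟙-cong (p ∣? (k + p ^ suc m)) (p ∣? k)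
                                                        (λ h → ∣m+n∣m⇒∣n (subst (p ∣_) (+-comm k _) h) (m∣m*n (p ^ m)))
                                                        (λ h → ∣m∣n⇒∣m+n h (m∣m*n (p ^ m)))) 1 ⟩
    ∑ (upTo (p ^ suc m)) multiple                  ≡⟨ cong (λ N → ∑ (upTo N) multiple) (*-comm p (p ^ m)) ⟩
    ∑ (upTo (p ^ m * p)) multiple                  ≡⟨ count-multiples (p ^ m) p ⟩
    p ^ m                                          ∎
  one : ∀ k → unit k + multiple (suc k) ≡ 1
  one k with p ∣? suc k
  ... | yes p∣k = cong (_+ 1) (𝟙-no (coprime? (suc k) (p ^ suc m)) (λ cop → coprime-^ʳ⇒∤ pp m cop p∣k))
  ... | no  p∤k = cong (_+ 0) (𝟙-yes (coprime? (suc k) (p ^ suc m))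
                    (Coprimality.sym (coprime-^ˡ {p} {suc k} (prime∤⇒coprime pp p∤k) (suc m))))

-- Either p divides the cofactor `h` and can be cancelled, or `h` is a divisor of pᵐ⁺¹ coprime to
-- it, hence 1.
∣prime-power : ∀ {p d} → Prime p → ∀ m → d ∣ p ^ suc m → d ∣ p ^ m ⊎ d ≡ p ^ suc m
∣prime-power {p} {d} pp m (divides h eq) with p ∣? h
... | yes (divides h′ refl) = inj₁ (divides h′ (*-cancelˡ-≡ (p ^ m) (h′ * d) p {{prime⇒nonZero pp}} (trans eq (lem h′ p d))))
  where
  lem : ∀ h p d → h * p * d ≡ p * (h * d)
  lem = solve-∀
... | no p∤h = inj₂ (sym (trans eq (trans (cong (_* d) h≡1) (*-identityˡ d))))
  where
  h≡1 : h ≡ 1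
  h≡1 = coprime-^ˡ {p} {h} (prime∤⇒coprime pp p∤h) (suc m) (divides d (trans eq (*-comm h d)) , ∣-refl)

-- Telescoping in `K`: the gcd grows from pᴷ to pᴷ⁺¹, that is by φ(pᴷ⁺¹), when pᴷ⁺¹ ∣ c, and does
-- not change otherwise.
gcd-prime-power : ∀ {p} → Prime p → ∀ c K → gcd c (p ^ K) ≡ ∑ (upTo (suc K)) (λ m → φ (p ^ m) * 𝟙 (p ^ m ∣? c))
gcd-prime-power {p} pp c zero    = trans (gcd-zeroʳ c)
  (sym (trans (+-identityʳ _) (trans (*-identityˡ _) (𝟙-yes (1 ∣? c) (1∣ c)))))
gcd-prime-power {p} pp c (suc K) = sym (trans (∑-last (suc K) f) (trans (cong (_+ f (suc K)) (sym (gcd-prime-power pp c K))) step))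
  where
  f : ℕ → ℕ
  f m = φ (p ^ m) * 𝟙 (p ^ m ∣? c)
  step : gcd c (p ^ K) + φ (p ^ suc K) * 𝟙 (p ^ suc K ∣? c) ≡ gcd c (p ^ suc K)
  step with p ^ suc K ∣? c
  ... | yes h = begin
    gcd c (p ^ K) + φ (p ^ suc K) * 1   ≡⟨ cong₂ _+_ (∣⇒gcd≡ (∣-trans (n∣m*n p) h)) (*-identityʳ (φ (p ^ suc K))) ⟩
    p ^ K + φ (p ^ suc K)               ≡⟨ +-comm (p ^ K) _ ⟩
    φ (p ^ suc K) + p ^ K               ≡⟨ φ-prime-power pp K ⟩
    p ^ suc K                           ≡⟨ ∣⇒gcd≡ h ⟨
    gcd c (p ^ suc K)                   ∎
    where
    open ≡-Reasoning
    ∣⇒gcd≡ : ∀ {m} → m ∣ c → gcd c m ≡ m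
    ∣⇒gcd≡ {m} m∣c = ∣-antisym (gcd[m,n]∣n c m) (gcd-greatest m∣c ∣-refl)
  ... | no h = trans (cong (gcd c (p ^ K) +_) (*-zeroʳ (φ (p ^ suc K)))) (trans (+-identityʳ _) (∣-antisym
      (gcd-greatest (gcd[m,n]∣m c _) (∣-trans (gcd[m,n]∣n c (p ^ K)) (n∣m*n p)))
      (gcd-greatest (gcd[m,n]∣m c _) smaller)))
    where
    smaller : gcd c (p ^ suc K) ∣ p ^ K
    smaller with ∣prime-power pp K (gcd[m,n]∣n c (p ^ suc K))
    ... | inj₁ d∣ = d∣
    ... | inj₂ eq = contradiction (subst (_∣ c) eq (gcd[m,n]∣m c (p ^ suc K))) h

-- The exponent of a prime in aᵏ - 1

geo≋k : ∀ {n d} → n ∣ d → ∀ k → geo (suc d) k ≋ k [ n ]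
geo≋k         n∣d zero    = ≋-refl
geo≋k {n} {d} n∣d (suc k) = ≋-+ (≋-refl {a = 1}) (≋-trans (≋-* (∣⇒≋1 n∣d) (geo≋k n∣d k)) (≋-reflexive (*-identityˡ k)))

-- The binomial coefficient k (k - 1) / 2, which is the coefficient of d in 1 + (1 + d) + ⋯ + (1 +
-- d)ᵏ⁻¹.
tri : ℕ → ℕ
tri zero    = 0
tri (suc k) = k + tri k

2*tri+k : ∀ k → 2 * tri k + k ≡ k * k
2*tri+k zero    = refl
2*tri+k (suc k) = trans (lem k (tri k)) (trans (cong (λ z → z + (2 * k + 1)) (2*tri+k k)) (lem′ k))
  where
  lem : ∀ k t → 2 * (k + t) + suc k ≡ 2 * t + k + (2 * k + 1)
  lem = solve-∀
  lem′ : ∀ k → k * k + (2 * k + 1) ≡ suc k * suc k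
  lem′ = solve-∀

geo-second-order : ∀ d k → geo (suc d) k ≋ k + d * tri k [ d * d ]
geo-second-order d zero    = ≋-reflexive (sym (*-zeroʳ d))
geo-second-order d (suc k) = ≋-trans (≋-+ (≋-refl {a = 1}) (≋-* (≋-refl {a = suc d}) (geo-second-order d k)))
  (congruent 0 (tri k) (lem d k (tri k)))
  where
  lem : ∀ d k t → 1 + suc d * (k + d * t) + 0 * (d * d) ≡ suc k + d * (k + t) + t * (d * d)
  lem = solve-∀

module _ {p : ℕ} (pp : Prime p) where
  private instance
    p≢0 : NonZero p
    p≢0 = prime⇒nonZero pp

  -- For odd p the second-order term d p (p - 1) / 2 is divisible by p². For p = 2 and d ≡ 2 (mod 4)
  -- the congruence fails, as the sum is then d + 2.
  geo-p-odd : ¬ 2 ∣ p → ∀ {d} → p ∣ d → geo (suc d) p ≋ p [ p * p ]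
  geo-p-odd 2∤p {d} p∣d = begin
    geo (suc d) p      ≈⟨ ≋-weaken (*-pres-∣ p∣d p∣d) (geo-second-order d p) ⟩
    p + d * tri p      ≈⟨ ≋-+ ≋-refl (∣⇒≋0 (*-pres-∣ p∣d p∣tri)) ⟩
    p + 0              ≡⟨ +-identityʳ p ⟩
    p                  ∎
    where
    open ≋-Reasoning (p * p)
    p∣tri : p ∣ tri p
    p∣tri with euclidsLemma 2 (tri p) pp (∣m+n∣m⇒∣n (subst (p ∣_) (sym (trans (+-comm p _) (2*tri+k p))) (m∣m*n p)) ∣-refl)
    ... | inj₂ h = h
    ... | inj₁ p∣2 with prime⇒irreducible prime[2] p∣2
    ... | inj₁ refl = contradiction pp ¬prime[1]
    ... | inj₂ refl = contradiction ∣-refl 2∤p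

  -- aᵖ - 1 is a - 1 times a geometric sum of p terms, each ≡ 1 modulo p, so one factor p is gained.
  lift-≋1 : ∀ {a} j → a ≋ 1 [ p ^ suc j ] → a ^ p ≋ 1 [ p ^ suc (suc j) ]
  lift-≋1 {zero}  j h = contradiction (≋-∣ h ((p ^ suc j) ∣0))
    λ p^∣1 → contradiction (∣1⇒≡1 (∣-trans (m∣m*n {p} (p ^ j)) p^∣1)) λ { refl → ¬prime[1] pp }
  lift-≋1 {suc d} j h = ≋-trans (≋-reflexive (^≡1+geo d p))
    (∣⇒≋1 (subst (_∣ d * geo (suc d) p) (*-comm (p ^ suc j) p) (*-pres-∣ p^∣d
      (≋-∣ (≋-sym (geo≋k (∣-trans (m∣m*n (p ^ j)) p^∣d) p)) ∣-refl))))
    where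
    p^∣d : p ^ suc j ∣ d
    p^∣d = ≋1⇒∣ h

  -- The geometric factor of aᵖ − 1 has exactly one factor p.
  descend-∣ : ∀ {d} → geo (suc d) p ≋ p [ p * p ] → ∀ j → p ^ suc j ∣ d * geo (suc d) p → p ^ j ∣ d
  descend-∣ {d} g≋p j h with ≋-∣ (≋-sym (≋-weaken (m∣m*n p) g≋p)) ∣-refl
  ... | divides w eq = Coprimality.coprime-divisor {n = w} {o = d}
      (coprime-^ˡ {p} {w} (prime∤⇒coprime pp p∤w) j)
      (*-cancelˡ-∣ p (subst (p * p ^ j ∣_) (trans (cong (d *_) eq) (lem d w p)) h))
    where
    lem : ∀ d w p → d * (w * p) ≡ p * (w * d)
    lem = solve-∀
    w≋1 : w ≋ 1 [ p ]
    w≋1 with subst (_≋ p [ p * p ]) eq g≋p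
    ... | congruent u v e = congruent u v (*-cancelʳ-≡ (w + u * p) (1 + v * p) p
            (trans (lem₁ w u p) (trans e (lem₂ v p))))
      where
      lem₁ : ∀ w u p → (w + u * p) * p ≡ w * p + u * (p * p)
      lem₁ = solve-∀
      lem₂ : ∀ v p → p + v * (p * p) ≡ (1 + v * p) * p
      lem₂ = solve-∀
    p∤w : ¬ p ∣ w
    p∤w p∣w = contradiction (∣1⇒≡1 (≋-∣ w≋1 p∣w)) λ { refl → ¬prime[1] pp }

  module _ (s : ℕ) (good : ∀ {d} → p ^ suc s ∣ d → geo (suc d) p ≋ p [ p * p ])
           {d : ℕ} (p^∣d : p ^ suc s ∣ d) (p^∤d : ¬ p ^ suc (suc s) ∣ d) where

    -- If p ∤ k, the geometric sum is prime to p and pˢ⁺² would divide d. If k = k′ p, `descend-∣`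
    -- removes one p from the modulus and from k; it is applied to `d′`, that is (1 + d)^k′ - 1,
    -- which is why `good` is assumed for every multiple of pˢ⁺¹. The cases used are s = 0 for odd
    -- p, and p = 2 with s = 2.
    ^≋1⇒prime-power∣ : ∀ j k → suc d ^ k ≋ 1 [ p ^ (suc s + j) ] → p ^ j ∣ k
    ^≋1⇒prime-power∣ zero    k h = 1∣ k
    ^≋1⇒prime-power∣ (suc j) k h with p ∣? k
    ... | no p∤k = contradiction (Coprimality.coprime-divisor {n = geo (suc d) k} {o = d}
              (coprime-^ˡ {p} (prime∤⇒coprime pp p∤geo) (suc (suc s)))
              (subst (p ^ suc (suc s) ∣_) (*-comm d _) p^∣)) p^∤d
      where
      p∤geo : ¬ p ∣ geo (suc d) k
      p∤geo = p∤k ∘ ≋-∣ (geo≋k (∣-trans (m∣m*n (p ^ s)) p^∣d) k)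
      p^∣ : p ^ suc (suc s) ∣ d * geo (suc d) k
      p^∣ = ≋1⇒∣ (subst (_≋ 1 [ p ^ suc (suc s) ]) (^≡1+geo d k)
        (≋-weaken (^-mono-∣ p (subst (suc (suc s) ≤_) (sym (+-suc (suc s) j)) (m≤m+n (suc (suc s)) j))) h))
    ... | yes (divides k′ refl) = subst (_∣ k′ * p) (*-comm (p ^ j) p) (*-monoˡ-∣ p (^≋1⇒prime-power∣ j k′ below))
      where
      d′ = d * geo (suc d) k′
      pow : suc d ^ (k′ * p) ≡ suc (d′ * geo (suc d′) p)
      pow = trans (sym (^-*-assoc (suc d) k′ p)) (trans (cong (_^ p) (^≡1+geo d k′)) (^≡1+geo d′ p))
      below : suc d ^ k′ ≋ 1 [ p ^ (suc s + j) ]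
      below = subst (_≋ 1 [ p ^ (suc s + j) ]) (sym (^≡1+geo d k′)) (∣⇒≋1 (descend-∣ (good (∣m⇒∣m*n _ p^∣d)) (suc s + j)
        (subst (λ e → p ^ e ∣ d′ * geo (suc d′) p) (+-suc (suc s) j)
          (≋1⇒∣ (subst (_≋ 1 [ p ^ (suc s + suc j) ]) pow h)))))

-- Inverses modulo n

module _ {n : ℕ} .{{_ : NonZero n}} where

  linear : ∀ a a′ → a * a′ ≋ 1 [ n ] → Permutation′ n
  linear a a′ h = permutation (λ x → (a * toℕ x) mod n) (λ x → (a′ * toℕ x) mod n)
    (inverse a a′ h) (inverse a′ a (≋-trans (≋-reflexive (*-comm a′ a)) h))
    where
    open ≋-Reasoning n
    inverse : ∀ a a′ → a * a′ ≋ 1 [ n ] → ∀ x → (a * toℕ ((a′ * toℕ x) mod n)) mod n ≡ x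
    inverse a a′ h x = toℕ-≋-injective (begin
      toℕ ((a * toℕ ((a′ * toℕ x) mod n)) mod n)   ≈⟨ toℕ-mod-≋ (a * toℕ ((a′ * toℕ x) mod n)) ⟩
      a * toℕ ((a′ * toℕ x) mod n)                 ≈⟨ ≋-* (≋-refl {a = a}) (toℕ-mod-≋ (a′ * toℕ x)) ⟩
      a * (a′ * toℕ x)                             ≡⟨ *-assoc a a′ (toℕ x) ⟨
      a * a′ * toℕ x                               ≈⟨ ≋-* h ≋-refl ⟩
      1 * toℕ x                                    ≡⟨ *-identityˡ (toℕ x) ⟩
      toℕ x                                        ∎)

coprime-inverse : ∀ {n a} .{{_ : NonZero n}} → Coprime n a → ∃[ a′ ] a * a′ ≋ 1 [ n ]
coprime-inverse {suc q} {a} cop with Coprimality.coprime-Bézout cop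
... | Bézout.-+ x y eq = y , ≋-sym (congruent x 0 (trans eq (lem y a)))
  where
  lem : ∀ y a → y * a ≡ a * y + 0
  lem = solve-∀
-- Here y a ≡ -1, so the inverse is -y, represented by `y * q` because q ≡ -1 modulo `suc q`. Adding
-- `q` to both sides avoids the negative number.
... | Bézout.+- x y eq = y * q , ≋-cancel-+ˡ q (begin
  q + a * (y * q)    ≡⟨ lem q a y ⟩
  q * (1 + y * a)    ≡⟨ cong (q *_) eq ⟩
  q * (x * suc q)    ≈⟨ ∣⇒≋0 (∣n⇒∣m*n q (n∣m*n x)) ⟩
  0                  ≈⟨ ∣⇒≋0 ∣-refl ⟨
  1 + q              ≡⟨ +-comm 1 q ⟩
  q + 1              ∎)
  where
  open ≋-Reasoning (suc q)
  lem : ∀ q a y → q + a * (y * q) ≡ q * (1 + y * a)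
  lem = solve-∀

-- Multiplicative orders modulo a prime

*-^ : ∀ m n k → (m * n) ^ k ≡ m ^ k * n ^ k
*-^ m n zero    = refl
*-^ m n (suc k) = trans (cong (m * n *_) (*-^ m n k)) (*-interchange m n (m ^ k) (n ^ k))

binomial : ∀ m x → suc x ^ m ≡ ∑ (upTo (suc m)) (λ j → (m C j) * x ^ j)
binomial zero    x = refl
binomial (suc m) x = begin
  suc x * suc x ^ m                                                                ≡⟨ cong (suc x *_) (binomial m x) ⟩
  B + x * B                                                                        ≡⟨ cong₂ _+_ front (sym (∑-*ˡ (upTo (suc m)) x b)) ⟩
  1 + ∑ (upTo (suc m)) (b ∘ suc) + ∑ (upTo (suc m)) (λ j → x * b j)                ≡⟨ cong suc (sym (∑-+ (upTo (suc m)) (b ∘ suc) (λ j → x * b j))) ⟩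
  1 + ∑ (upTo (suc m)) (λ j → b (suc j) + x * b j)                                 ≡⟨ cong suc (∑-cong (upTo (suc m)) pascal) ⟩
  1 + ∑ (upTo (suc m)) (λ j → (suc m C suc j) * x ^ suc j)                           ≡⟨ ∑-head (suc m) (λ j → (suc m C j) * x ^ j) ⟨
  ∑ (upTo (suc (suc m))) (λ j → (suc m C j) * x ^ j)                                 ∎
  where
  open ≡-Reasoning
  b : ℕ → ℕ
  b j = (m C j) * x ^ j
  B = ∑ (upTo (suc m)) b
  front : B ≡ 1 + ∑ (upTo (suc m)) (b ∘ suc)
  front = begin
    B                              ≡⟨ +-identityʳ B ⟨
    B + 0                          ≡⟨ cong (λ c → B + c * x ^ suc m) (k>n⇒nCk≡0 (n<1+n m)) ⟨
    B + b (suc m)                  ≡⟨ ∑-last (suc m) b ⟨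
    ∑ (upTo (suc (suc m))) b       ≡⟨ ∑-head (suc m) b ⟩
    1 + ∑ (upTo (suc m)) (b ∘ suc) ∎
  lem : ∀ c c′ x y → c′ * (x * y) + x * (c * y) ≡ (c + c′) * (x * y)
  lem = solve-∀
  pascal : ∀ j → b (suc j) + x * b j ≡ (suc m C suc j) * x ^ suc j
  pascal j = trans (lem (m C j) (m C suc j) x (x ^ j)) (cong (_* x ^ suc j) (nCk+nC[k+1]≡[n+1]C[k+1] m j))

-- Bézout with nonnegative coefficients, g + y k = x j or its mirror image: multiplying a^g by a^(y
-- k) ≡ 1 gives a^(x j) ≡ 1.
^≋1-gcd : ∀ {n a j k} → a ^ j ≋ 1 [ n ] → a ^ k ≋ 1 [ n ] → a ^ gcd j k ≋ 1 [ n ]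
^≋1-gcd {n} {a} {j} {k} hj hk = [ (λ (x , y , eq) → cancel hj hk x y eq) , (λ (x , y , eq) → cancel hk hj y x eq) ]′
  (bezout (Bézout.identity (gcd-GCD j k)))
  where
  open Bézout.Identity
  g = gcd j k
  bezout : Bézout.Identity g j k → (∃[ x ] ∃[ y ] g + y * k ≡ x * j) ⊎ (∃[ x ] ∃[ y ] g + x * j ≡ y * k)
  bezout (+- x y eq) = inj₁ (x , y , eq)
  bezout (-+ x y eq) = inj₂ (x , y , eq)
  cancel : ∀ {j k} → a ^ j ≋ 1 [ n ] → a ^ k ≋ 1 [ n ] → ∀ x y → g + y * k ≡ x * j → a ^ g ≋ 1 [ n ]
  cancel {j} {k} hj hk x y eq = begin
    a ^ g                  ≡⟨ *-identityʳ (a ^ g) ⟨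
    a ^ g * 1              ≈⟨ ≋-* (≋-refl {a = a ^ g}) (^≋1-∣ {a = a} {j = k} hk (n∣m*n y)) ⟨
    a ^ g * a ^ (y * k)    ≡⟨ ^-distribˡ-+-* a g (y * k) ⟨
    a ^ (g + y * k)        ≡⟨ cong (a ^_) eq ⟩
    a ^ (x * j)            ≈⟨ ^≋1-∣ {a = a} {j = j} hj (n∣m*n x) ⟩
    1                      ∎
    where open ≋-Reasoning n

record HasOrder (n d a : ℕ) : Set where
  constructor hasOrder
  field
    order-^ : a ^ d ≋ 1 [ n ]
    order-∣ : ∀ k → a ^ k ≋ 1 [ n ] → d ∣ k

open HasOrder

-- If (a b)ᵏ ≡ 1, raising to the power e removes b, so d ∣ e k and by coprimality d ∣ k; likewise
-- for e.
HasOrder-* : ∀ {n d e a b} → Coprime d e → HasOrder n d a → HasOrder n e b → HasOrder n (d * e) (a * b)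
HasOrder-* {n} {d} {e} {a} {b} cop ha hb = hasOrder
  (subst (_≋ 1 [ n ]) (sym (*-^ a b (d * e))) (≋-* (^≋1-∣ {a = a} {d} (order-^ ha) (m∣m*n e)) (^≋1-∣ {a = b} {e} (order-^ hb) (n∣m*n d))))
  (λ k h → coprime-*-∣ cop (half {a} {b} cop (order-∣ ha) (order-^ hb) k h)
    (half {b} {a} (Coprimality.sym cop) (order-∣ hb) (order-^ ha) k (subst (λ c → c ^ k ≋ 1 [ n ]) (*-comm a b) h)))
  where
  half : ∀ {a b d e} → Coprime d e → (∀ k → a ^ k ≋ 1 [ n ] → d ∣ k) → b ^ e ≋ 1 [ n ] →
         ∀ k → (a * b) ^ k ≋ 1 [ n ] → d ∣ k
  half {a} {b} {d} {e} cop ha hb k h = Coprimality.coprime-divisor cop (ha (e * k) (begin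
    a ^ (e * k)                    ≡⟨ *-identityʳ _ ⟨
    a ^ (e * k) * 1                ≈⟨ ≋-* (≋-refl {a = a ^ (e * k)}) (^≋1-∣ {a = b} {e} hb (m∣m*n k)) ⟨
    a ^ (e * k) * b ^ (e * k)      ≡⟨ *-^ a b (e * k) ⟨
    (a * b) ^ (e * k)              ≈⟨ ^≋1-∣ {a = a * b} h (n∣m*n e) ⟩
    1                              ∎))
    where open ≋-Reasoning n

prime-divisor : ∀ n → .{{NonZero n}} → n ≡ 1 ⊎ ∃[ q ] (Prime q × q ∣ n)
prime-divisor n with factorise n
... | record { factors = []     ; isFactorisation = eq } = inj₁ eq
... | record { factors = f ∷ fs ; isFactorisation = eq ; factorsPrime = pf ∷ _ } =
  inj₂ (f , pf , subst (f ∣_) (sym eq) (m∣m*n _))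

extract-power : ∀ {q} → Prime q → ∀ n → .{{NonZero n}} → ∃[ j ] ∃[ e ] (n ≡ q ^ j * e × ¬ q ∣ e)
extract-power {q} pq = <-rec (λ n → .{{NonZero n}} → ∃[ j ] ∃[ e ] (n ≡ q ^ j * e × ¬ q ∣ e)) step
  where
  step : ∀ n → (∀ {m} → m < n → .{{NonZero m}} → ∃[ j ] ∃[ e ] (m ≡ q ^ j * e × ¬ q ∣ e)) →
         .{{NonZero n}} → ∃[ j ] ∃[ e ] (n ≡ q ^ j * e × ¬ q ∣ e)
  step n rec with q ∣? n
  ... | no  q∤n = 0 , n , sym (+-identityʳ n) , q∤n
  ... | yes (divides zero refl) = contradiction refl (≢-nonZero⁻¹ 0)
  ... | yes (divides m@(suc _) refl) with rec (m<m*n m q (nonTrivial⇒n>1 q {{prime⇒nonTrivial pq}}))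
  ... | j , e , eq , q∤e = suc j , e , trans (cong (_* q) eq) (lem (q ^ j) e q) , q∤e
    where
    lem : ∀ x e q → x * e * q ≡ q * x * e
    lem = solve-∀

module _ {q : ℕ} (pp : Prime (suc q)) where
  private
    p : ℕ
    p = suc q

    0<q : 0 < q
    0<q = s≤s⁻¹ (nonTrivial⇒n>1 p {{prime⇒nonTrivial pp}})

    p∤<p : ∀ {x} → 0 < x → x < p → ¬ p ∣ x
    p∤<p {suc x} _ x<p p∣x = <⇒≱ x<p (∣⇒≤ p∣x)

  -- Multiplication by a permutes the nonzero residues, so their product absorbs a factor a^(p−1).
  fermat : ∀ {a} → ¬ p ∣ a → a ^ q ≋ 1 [ p ]
  fermat {zero}  p∤a = contradiction (p ∣0) p∤a
  fermat {a@(suc d)} p∤a with coprime-inverse {p} (prime∤⇒coprime pp p∤a)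
  ... | a′ , aa′≋1 = ≋-trans (≋-reflexive (^≡1+geo d q)) (∣⇒≋1
      ([ (λ p∣P → contradiction p∣P p∤P) , (λ h → h) ]′ (euclidsLemma P c pp p∣Pc)))
    where
    π = linear {p} a a′ aa′≋1
    -- The residue 0 is fixed by `π`; with weight 1 in its place, the product over all of `Fin p` is
    -- the product `P` of the nonzero residues.
    f : Fin p → ℕ
    f zero    = 1
    f (suc i) = suc (toℕ i)
    g : ∀ {m} → Fin m → ℕ
    g i = suc (toℕ i)
    P = ∏Fin {q} g
    c = d * geo a q
    ∏Fin-≋ : ∀ {m} (u v : Fin m → ℕ) → (∀ i → u i ≋ a * v i [ p ]) → ∏Fin u ≋ a ^ m * ∏Fin v [ p ]
    ∏Fin-≋ {zero}  u v h = ≋-refl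
    ∏Fin-≋ {suc m} u v h = ≋-trans (≋-* (h zero) (∏Fin-≋ (u ∘ suc) (v ∘ suc) (h ∘ suc)))
      (≋-reflexive (*-interchange a (v zero) (a ^ m) _))
    f-π : ∀ i → f (π ⟨$⟩ʳ suc i) ≋ a * g i [ p ]
    f-π i with π ⟨$⟩ʳ suc i | toℕ-mod-≋ {p} (a * toℕ {p} (suc i))
    ... | zero  | eq = contradiction (≋-∣ eq (p ∣0)) λ h →
                         [ p∤a , p∤<p (s≤s z≤n) (toℕ<n {p} (suc i)) ]′ (euclidsLemma a (suc (toℕ i)) pp h)
    ... | suc j | eq = eq
    f-π0 : f (π ⟨$⟩ʳ zero) ≡ 1
    f-π0 = cong f (toℕ-≋-injective {p} {π ⟨$⟩ʳ zero} {zero}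
      (≋-trans (toℕ-mod-≋ (a * 0)) (≋-reflexive (*-zeroʳ a))))
    P≋ : P ≋ a ^ q * P [ p ]
    P≋ = begin
      P                                                              ≡⟨ *-identityˡ P ⟨
      ∏Fin f                                                         ≡⟨ ∏Fin-permute f π ⟩
      f (π ⟨$⟩ʳ zero) * ∏Fin (λ i → f (π ⟨$⟩ʳ suc i))                ≡⟨ cong (_* ∏Fin (λ i → f (π ⟨$⟩ʳ suc i))) f-π0 ⟩
      1 * ∏Fin (λ i → f (π ⟨$⟩ʳ suc i))                              ≡⟨ *-identityˡ _ ⟩
      ∏Fin (λ i → f (π ⟨$⟩ʳ suc i))                                  ≈⟨ ∏Fin-≋ (λ i → f (π ⟨$⟩ʳ suc i)) g f-π ⟩
      a ^ q * P                                                      ∎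
      where open ≋-Reasoning p
    p∣Pc : p ∣ P * c
    p∣Pc = ≋0⇒∣ (≋-sym (≋-cancel-+ˡ P (≋-trans (≋-reflexive (+-identityʳ P)) (≋-trans P≋
      (≋-reflexive (trans (cong (_* P) (^≡1+geo d q)) (cong (P +_) (*-comm c P))))))))
    p∤P : ¬ p ∣ P
    p∤P = go {q} g (λ i → p∤<p (s≤s z≤n) (s≤s (toℕ<n i)))
      where
      go : ∀ {m} (u : Fin m → ℕ) → (∀ i → ¬ p ∣ u i) → ¬ p ∣ ∏Fin u
      go {zero}  u h p∣1 = p∤<p (s≤s z≤n) (s≤s 0<q) p∣1
      go {suc m} u h p∣  = [ h zero , go (u ∘ suc) (h ∘ suc) ]′ (euclidsLemma (u zero) _ pp p∣)

  -- Summing (x+1)^(m+1) − x^(m+1) over x < p telescopes to p^(m+1).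
  p∣power-sum : ∀ m → m < q → p ∣ ∑ (upTo p) (_^ m)
  p∣power-sum = <-rec (λ m → m < q → p ∣ S m) step
    where
    S : ℕ → ℕ
    S m = ∑ (upTo p) (_^ m)
    step : ∀ m → (∀ {j} → j < m → j < q → p ∣ S j) → m < q → p ∣ S m
    -- The telescoped identity reads pᵐ⁺¹ = R + (m + 1) S(m), where `R` collects the lower power
    -- sums and is divisible by p by induction; the factor m + 1 is cancelled because m + 1 < p.
    step m rec m<q = [ (λ h → contradiction h (p∤<p (s≤s z≤n) (s≤s m<q))) , (λ h → h) ]′
      (euclidsLemma (suc m) (S m) pp (∣m+n∣m⇒∣n (subst (p ∣_) telescope (m∣m*n (p ^ m))) p∣R))
      where
      c : ℕ → ℕ
      c j = suc m C j
      R = ∑ (upTo m) (λ j → c j * S j)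
      p∣∑ : ∀ xs (f : ℕ → ℕ) → (∀ {x} → x ∈ xs → p ∣ f x) → p ∣ ∑ xs f
      p∣∑ []       f h = p ∣0
      p∣∑ (x ∷ xs) f h = ∣m∣n⇒∣m+n (h (here refl)) (p∣∑ xs f (h ∘ there))
      p∣R : p ∣ R
      p∣R = p∣∑ (upTo m) (λ j → c j * S j) λ {j} j∈ → ∣n⇒∣m*n (c j) (rec (∈-upTo⁻ j∈) (<-trans (∈-upTo⁻ j∈) m<q))
      expansion : ∑ (upTo p) (λ x → suc x ^ suc m) ≡ R + c m * S m + c (suc m) * S (suc m)
      expansion = begin
        ∑ (upTo p) (λ x → suc x ^ suc m)                                        ≡⟨ ∑-cong (upTo p) (binomial (suc m)) ⟩
        ∑ (upTo p) (λ x → ∑ (upTo (suc (suc m))) (λ j → c j * x ^ j))           ≡⟨ ∑-swap (upTo p) (upTo (suc (suc m))) (λ x j → c j * x ^ j) ⟩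
        ∑ (upTo (suc (suc m))) (λ j → ∑ (upTo p) (λ x → c j * x ^ j))           ≡⟨ ∑-cong (upTo (suc (suc m))) (λ j → ∑-*ˡ (upTo p) (c j) (_^ j)) ⟩
        ∑ (upTo (suc (suc m))) (λ j → c j * S j)                                ≡⟨ ∑-last (suc m) (λ j → c j * S j) ⟩
        ∑ (upTo (suc m)) (λ j → c j * S j) + c (suc m) * S (suc m)              ≡⟨ cong (_+ c (suc m) * S (suc m)) (∑-last m (λ j → c j * S j)) ⟩
        R + c m * S m + c (suc m) * S (suc m)                                   ∎
        where open ≡-Reasoning
      cm : c m ≡ suc m
      cm = trans (nCk≡nC[n∸k] (n≤1+n m)) (trans (cong (suc m C_) (m+n∸n≡m 1 m)) (nC1≡n (suc m)))
      telescope : p ^ suc m ≡ R + suc m * S m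
      telescope = +-cancelˡ-≡ (S (suc m)) _ _ (begin
        S (suc m) + p ^ suc m                        ≡⟨ ∑-last p (_^ suc m) ⟨
        ∑ (upTo (suc p)) (_^ suc m)                  ≡⟨ ∑-head p (_^ suc m) ⟩
        ∑ (upTo p) (λ x → suc x ^ suc m)             ≡⟨ expansion ⟩
        R + c m * S m + c (suc m) * S (suc m)        ≡⟨ cong₂ (λ u v → R + u * S m + v * S (suc m)) cm (nCn≡1 (suc m)) ⟩
        R + suc m * S m + 1 * S (suc m)              ≡⟨ lem R (suc m * S m) (S (suc m)) ⟩
        S (suc m) + (R + suc m * S m)                ∎)
        where
        open ≡-Reasoning
        lem : ∀ x y z → x + y + 1 * z ≡ z + (x + y)
        lem = solve-∀

  -- Otherwise the power sum would be ≡ p - 1, against `p∣power-sum`. The positive exponent makes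
  -- the residue 0 contribute nothing.
  some-^≢1 : ∀ m → suc m < q → ∃[ x ] (¬ p ∣ x × ¬ x ^ suc m ≋ 1 [ p ])
  some-^≢1 m m<q with anyUpTo? (λ x → ¬? (≋? {p} (suc x ^ suc m) 1)) q
  ... | yes (x , x<q , h) = suc x , p∤<p (s≤s z≤n) (s≤s x<q) , h
  ... | no none = contradiction (≋-∣ S≋q (p∣power-sum (suc m) m<q)) (p∤<p 0<q (n<1+n q))
    where
    open ≋-Reasoning p
    all≋1 : ∀ {x} → x < q → suc x ^ suc m ≋ 1 [ p ]
    all≋1 {x} x<q = decidable-stable (≋? {p} (suc x ^ suc m) 1) (λ h → none (x , x<q , h))
    ∑-≋ : ∀ xs (f g : ℕ → ℕ) → (∀ {x} → x ∈ xs → f x ≋ g x [ p ]) → ∑ xs f ≋ ∑ xs g [ p ]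
    ∑-≋ []       f g h = ≋-refl
    ∑-≋ (x ∷ xs) f g h = ≋-+ (h (here refl)) (∑-≋ xs f g (h ∘ there))
    S≋q : ∑ (upTo p) (_^ suc m) ≋ q [ p ]
    S≋q = begin
      ∑ (upTo p) (_^ suc m)                   ≡⟨ ∑-head q (_^ suc m) ⟩
      ∑ (upTo q) (λ x → suc x ^ suc m)        ≈⟨ ∑-≋ (upTo q) (λ x → suc x ^ suc m) (λ _ → 1) (all≋1 ∘ ∈-upTo⁻) ⟩
      ∑ (upTo q) (λ _ → 1)                    ≡⟨ ∑-const (upTo q) 1 ⟩
      length (upTo q) * 1                     ≡⟨ trans (*-identityʳ _) (length-upTo q) ⟩
      q                                       ∎

  -- Write q = r lʲ⁺¹ and choose x with x^(q / l) ≢ 1. Then b = xʳ is killed by lʲ⁺¹ (Fermat) but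
  -- not by lʲ, and a gcd of k with lʲ⁺¹ that is proper would divide lʲ.
  order-prime-power : ∀ {l} → Prime l → ∀ j → l ^ suc j ∣ q → ∃[ b ] HasOrder p (l ^ suc j) b
  order-prime-power {l} pl j (divides r eq) with r * l ^ j in rl^j
  ... | zero = contradiction (trans eq (trans (lem r l (l ^ j)) (trans (cong (l *_) rl^j) (*-zeroʳ l)))) (≢-sym (<⇒≢ 0<q))
    where
    lem : ∀ r l x → r * (l * x) ≡ l * (r * x)
    lem = solve-∀
  ... | suc m with some-^≢1 m (subst (suc m <_) (sym (trans eq (trans (lem r l (l ^ j)) (cong (_* l) rl^j))))
                    (m<m*n (suc m) l (nonTrivial⇒n>1 l {{prime⇒nonTrivial pl}})))
    where
    lem : ∀ r l x → r * (l * x) ≡ r * x * l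
    lem = solve-∀
  ... | x , p∤x , x^≢1 = b , hasOrder b^≋1 b-order
    where
    b = x ^ r
    b^≋1 : b ^ (l ^ suc j) ≋ 1 [ p ]
    b^≋1 = subst (_≋ 1 [ p ]) (trans (cong (x ^_) eq) (sym (^-*-assoc x r (l ^ suc j)))) (fermat p∤x)
    b^≢1 : ¬ b ^ (l ^ j) ≋ 1 [ p ]
    b^≢1 h = x^≢1 (subst (_≋ 1 [ p ]) (trans (^-*-assoc x r (l ^ j)) (cong (x ^_) rl^j)) h)
    b-order : ∀ k → b ^ k ≋ 1 [ p ] → l ^ suc j ∣ k
    b-order k h with ∣prime-power pl j (gcd[m,n]∣n k (l ^ suc j))
    ... | inj₁ g∣ = contradiction (^≋1-∣ {a = b} (^≋1-gcd {a = b} {k} {l ^ suc j} h b^≋1) g∣) b^≢1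
    ... | inj₂ g≡ = subst (_∣ k) g≡ (gcd[m,n]∣m k (l ^ suc j))

  -- The full power of a prime l is split off from d; the two factors are coprime, so elements of
  -- these orders multiply. The case d = q is a primitive root modulo p.
  order-divisor : ∀ d → d ∣ q → ∃[ b ] HasOrder p d b
  order-divisor = <-rec (λ d → d ∣ q → ∃[ b ] HasOrder p d b) step
    where
    step : ∀ d → (∀ {e} → e < d → e ∣ q → ∃[ b ] HasOrder p e b) → d ∣ q → ∃[ b ] HasOrder p d b
    step zero      rec 0∣q = contradiction (sym (0∣⇒≡0 0∣q)) (<⇒≢ 0<q)
    step d@(suc _) rec d∣q with prime-divisor d
    ... | inj₁ d≡1 = 1 , subst (λ e → HasOrder p e 1) (sym d≡1) (hasOrder ≋-refl (λ k _ → 1∣ k))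
    ... | inj₂ (l , pl , l∣d) with extract-power pl d
    ... | zero  , e , eq , l∤e = contradiction (subst (l ∣_) (trans eq (+-identityʳ e)) l∣d) l∤e
    ... | suc j , e , eq , l∤e
      with order-prime-power pl j (∣-trans (subst (l ^ suc j ∣_) (sym eq) (m∣m*n e)) d∣q)
         | rec e<d (∣-trans (subst (e ∣_) (sym eq) (n∣m*n (l ^ suc j))) d∣q)
      where
      e≢0 : NonZero e
      e≢0 = ≢-nonZero λ { refl → l∤e (l ∣0) }
      1<l^ : 1 < l ^ suc j
      1<l^ = <-≤-trans (nonTrivial⇒n>1 l {{prime⇒nonTrivial pl}})
        (m≤m*n l (l ^ j) {{m^n≢0 l j {{prime⇒nonZero pl}}}})
      e<d : e < d
      e<d = subst (e <_) (trans (*-comm e _) (sym eq)) (m<m*n e (l ^ suc j) {{e≢0}} 1<l^)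
    ... | b , hb | b′ , hb′ = b * b′ ,
      subst (λ n → HasOrder p n (b * b′)) (sym eq) (HasOrder-* (coprime-^ˡ {l} {e} (prime∤⇒coprime pl l∤e) (suc j)) hb hb′)

  -- Units modulo powers of a prime

  φ-value : ∀ m → φ (p ^ suc m) ≡ q * p ^ m
  φ-value m = +-cancelʳ-≡ (p ^ m) _ _ (trans (φ-prime-power pp m) (+-comm (p ^ m) _))

  euler : ∀ {a} → ¬ p ∣ a → ∀ m → a ^ φ (p ^ suc m) ≋ 1 [ p ^ suc m ]
  euler {a} p∤a m = subst (λ e → a ^ e ≋ 1 [ p ^ suc m ]) (sym (φ-value m)) (go m)
    where
    go : ∀ m → a ^ (q * p ^ m) ≋ 1 [ p ^ suc m ]
    go zero    = subst₂ (λ e n → a ^ e ≋ 1 [ n ]) (sym (*-identityʳ q)) (sym (*-identityʳ p)) (fermat p∤a)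
    go (suc m) = subst (_≋ 1 [ p ^ suc (suc m) ])
      (trans (^-*-assoc a (q * p ^ m) p) (cong (a ^_) (lem q (p ^ m) p)))
      (lift-≋1 pp m (go m))
      where
      lem : ∀ q x p → q * x * p ≡ q * (p * x)
      lem = solve-∀

  -- If g itself fails modulo p², then g (1 + p) works, as (1 + p)^(p−1) ≡ 1 + (p−1) p.
  primitive-mod-p² : ∃[ g ] (HasOrder p q g × ¬ g ^ q ≋ 1 [ p ^ 2 ])
  primitive-mod-p² with order-divisor q ∣-refl
  ... | g , hg with ≋? {p ^ 2} {{m^n≢0 p 2}} (g ^ q) 1
  ... | no h = g , hg , h
  ... | yes h = g * suc p , hasOrder (≋-trans (≋-^ g′≋g q) (order-^ hg))
                  (λ k e → order-∣ hg k (≋-trans (≋-sym (≋-^ g′≋g k)) e)) , fails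
    where
    g′≋g : g * suc p ≋ g [ p ]
    g′≋g = congruent 0 g (lem g p)
      where
      lem : ∀ g p → g * suc p + 0 ≡ g + g * p
      lem = solve-∀
    fails : ¬ (g * suc p) ^ q ≋ 1 [ p ^ 2 ]
    fails e = p∤<p 0<q (n<1+n q) (≋-∣ (geo≋k ∣-refl q) (*-cancelˡ-∣ p
      (subst (_∣ p * geo (suc p) q) (cong (p *_) (*-identityʳ p)) (≋1⇒∣ (begin
        suc (p * geo (suc p) q)      ≡⟨ ^≡1+geo p q ⟨
        suc p ^ q                    ≡⟨ *-identityˡ _ ⟨
        1 * suc p ^ q                ≈⟨ ≋-* h ≋-refl ⟨
        g ^ q * suc p ^ q            ≡⟨ *-^ g (suc p) q ⟨
        (g * suc p) ^ q              ≈⟨ e ⟩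
        1                            ∎)))))
      where open ≋-Reasoning (p ^ 2)

  -- Modulo p the order of g forces k = k′ q, and g^q = 1 + d with p dividing d exactly once, so
  -- `^≋1⇒prime-power∣` yields the p-part of k′ for every m with the same g.
  primitive-root : ¬ 2 ∣ p → ∃[ g ] (¬ p ∣ g × ∀ m k → g ^ k ≋ 1 [ p ^ m ] → φ (p ^ m) ∣ k)
  primitive-root 2∤p with primitive-mod-p²
  ... | g , hg , g^≢1 = g , p∤g , sharp
    where
    p∤g : ¬ p ∣ g
    p∤g p∣g = p∤<p (s≤s z≤n) (s≤s 0<q) (≋-∣ (order-^ hg) (∣-trans p∣g (subst (λ e → g ∣ g ^ e) (suc-pred q {{>-nonZero 0<q}}) (m∣m*n (g ^ pred q)))))
    d = pred (g ^ q)
    g^q≡ : g ^ q ≡ suc d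
    g^q≡ = sym (suc-pred (g ^ q) {{m^n≢0 g q {{≢-nonZero λ { refl → p∤g (p ∣0) }}}}})
    sharp : ∀ m k → g ^ k ≋ 1 [ p ^ m ] → φ (p ^ m) ∣ k
    sharp zero    k h = 1∣ k
    sharp (suc m) k h with order-∣ hg k (≋-weaken (m∣m*n (p ^ m)) h)
    ... | divides k′ refl = subst₂ _∣_ (sym (φ-value m)) (*-comm q k′) (*-monoʳ-∣ q
      (^≋1⇒prime-power∣ pp 0 (λ p∣ → geo-p-odd pp 2∤p (∣-trans (m∣m*n 1) p∣)) {d}
        (≋1⇒∣ (subst₂ (λ a n → a ≋ 1 [ n ]) g^q≡ (sym (*-identityʳ p)) (order-^ hg)))
        (λ p²∣d → g^≢1 (subst (_≋ 1 [ p ^ 2 ]) (sym g^q≡) (∣⇒≋1 p²∣d)))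
        m k′ (subst (_≋ 1 [ p ^ suc m ]) (trans (cong (g ^_) (*-comm k′ q)) (trans (sym (^-*-assoc g q k′)) (cong (_^ k′) g^q≡))) h)))

-- Orders in ℤₙ and powers of two

module _ {n : ℕ} .{{_ : NonZero n}} where

  toℕ-^ₙ : ∀ (a : Fin n) k → toℕ (a ^ₙ k) ≋ toℕ a ^ k [ n ]
  toℕ-^ₙ a zero    = toℕ-mod-≋ 1
  toℕ-^ₙ a (suc k) = ≋-trans (toℕ-mod-≋ _) (≋-* (≋-refl {a = toℕ a}) (toℕ-^ₙ a k))

  ^ₙ≡1⇒≋ : ∀ (a : Fin n) k → a ^ₙ k ≡ 1ₙ → toℕ a ^ k ≋ 1 [ n ]
  ^ₙ≡1⇒≋ a k eq = ≋-trans (≋-sym (toℕ-^ₙ a k)) (≋-trans (≋-reflexive (cong toℕ eq)) (toℕ-mod-≋ 1))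

  ≋⇒^ₙ≡1 : ∀ (a : Fin n) k → toℕ a ^ k ≋ 1 [ n ] → a ^ₙ k ≡ 1ₙ
  ≋⇒^ₙ≡1 a k h = toℕ-≋-injective (≋-trans (toℕ-^ₙ a k) (≋-trans h (≋-sym (toℕ-mod-≋ 1))))

  unit⇒≋ : ∀ {a a′ : Fin n} → a *ₙ a′ ≡ 1ₙ → toℕ a * toℕ a′ ≋ 1 [ n ]
  unit⇒≋ {a} {a′} eq = ≋-trans (≋-sym (toℕ-mod-≋ (toℕ a * toℕ a′))) (≋-trans (≋-reflexive (cong toℕ eq)) (toℕ-mod-≋ 1))

  ≋⇒unit : ∀ a a′ → a * a′ ≋ 1 [ n ] → IsUnit {n} (a mod n)
  ≋⇒unit a a′ h = a′ mod n , toℕ-≋-injective (≋-trans (toℕ-mod-≋ _)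
    (≋-trans (≋-* (toℕ-mod-≋ a) (toℕ-mod-≋ a′)) (≋-trans h (≋-sym (toℕ-mod-≋ 1)))))

  -- The bound e ≤ n enters twice: it places `e` among the candidates that `order` searches for each
  -- unit, and it keeps the default value n of that search from falling below `e` for `g`.
  maxOrder-≡ : ∀ e g → 1 ≤ e → e ≤ n → (∀ a → IsUnit a → toℕ a ^ e ≋ 1 [ n ]) →
               (∀ k → g ^ k ≋ 1 [ n ] → e ∣ k) → g ^ e ≋ 1 [ n ] → maxOrder n ≡ e
  maxOrder-≡ e@(suc e′) g 1≤e e≤n exponent sharp g^e≋1 = ≤-antisym
    (max≤v⁺ z≤n (ListAll.tabulate upper))
    (v≤max⁺ 0 (map order units) (inj₂ (lose (∈-map⁺ order g∈units) lower)))
    where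
    units : List (Fin n)
    units = filter (isUnit? {n}) (allFin n)
    g∈units : g mod n ∈ units
    g∈units = ∈-filter⁺ isUnit? (∈-allFin (g mod n)) (≋⇒unit g (g ^ e′) g^e≋1)
    upper : ∀ {o} → o ∈ map order units → o ≤ e
    upper o∈ with ∈-map⁻ order o∈
    ... | a , a∈ , refl = min≤v⁺ n _ (inj₂ (lose
      (∈-filter⁺ (λ k → a ^ₙ k ≟ 1ₙ) (∈-map⁺ suc (∈-upTo⁺ e≤n))
        (≋⇒^ₙ≡1 a e (exponent a (proj₂ (∈-filter⁻ isUnit? {xs = allFin n} a∈))))) ≤-refl))
    divisible : ∀ {k} → k ∈ filter (λ k → (g mod n) ^ₙ k ≟ 1ₙ) (map suc (upTo n)) → e ≤ k
    divisible k∈ with ∈-filter⁻ (λ k → (g mod n) ^ₙ k ≟ 1ₙ) {xs = map suc (upTo n)} k∈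
    ... | k∈′ , eq with ∈-map⁻ suc k∈′
    ... | k , _ , refl = ∣⇒≤ (sharp (suc k) (≋-trans (≋-^ (≋-sym (toℕ-mod-≋ g)) (suc k)) (^ₙ≡1⇒≋ (g mod n) (suc k) eq)))
    lower : e ≤ order (g mod n)
    lower = v≤min⁺ e≤n (ListAll.tabulate divisible)

unit⇒∤ : ∀ {n p a a′} → Prime p → p ∣ n → a * a′ ≋ 1 [ n ] → ¬ p ∣ a
unit⇒∤ {a′ = a′} pp p∣n h p∣a = contradiction (∣1⇒≡1 (≋-∣ (≋-weaken p∣n h) (∣m⇒∣m*n a′ p∣a))) λ { refl → ¬prime[1] pp }

exponent-2^ : ℕ → ℕ
exponent-2^ 0                   = 1
exponent-2^ 1                   = 1
exponent-2^ 2                   = 2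
exponent-2^ (suc (suc (suc j))) = 2 * 2 ^ j

exponent-2^-nonZero : ∀ m → NonZero (exponent-2^ m)
exponent-2^-nonZero 0                   = _
exponent-2^-nonZero 1                   = _
exponent-2^-nonZero 2                   = _
exponent-2^-nonZero (suc (suc (suc j))) = m^n≢0 2 (suc j)

-- For a = 1 + 2 t one has a² = 1 + 4 (t² + t), and t² = 2 `tri t` + t exhibits t² + t as even.
odd⇒^2≋1 : ∀ {a} → ¬ 2 ∣ a → a ^ 2 ≋ 1 [ 2 ^ 3 ]
odd⇒^2≋1 {zero}  2∤a = contradiction (2 ∣0) 2∤a
odd⇒^2≋1 {suc d} 2∤a = square (≋1⇒∣ (≋-trans (≋-reflexive (sym (*-identityʳ (suc d)))) (fermat prime[2] 2∤a)))
  where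
  lem₁ : ∀ t → suc (t * 2) * (suc (t * 2) * 1) + 0 ≡ 1 + 4 * t + 4 * (t * t)
  lem₁ = solve-∀
  lem₂ : ∀ t s → 1 + 4 * t + 4 * (2 * s + t) ≡ 1 + (t + s) * 8
  lem₂ = solve-∀
  square : ∀ {d} → 2 ∣ d → suc d ^ 2 ≋ 1 [ 2 ^ 3 ]
  square (divides t refl) = congruent 0 (t + tri t)
    (trans (lem₁ t) (trans (cong (λ z → 1 + 4 * t + 4 * z) (sym (2*tri+k t))) (lem₂ t (tri t))))

odd⇒^exponent-2^≋1 : ∀ {a} → ¬ 2 ∣ a → ∀ m → a ^ exponent-2^ m ≋ 1 [ 2 ^ m ]
odd⇒^exponent-2^≋1 2∤a 0 = ≋-mod-1
odd⇒^exponent-2^≋1 2∤a 1 = fermat prime[2] 2∤a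
odd⇒^exponent-2^≋1 2∤a 2 = ≋-weaken (divides 2 refl) (odd⇒^2≋1 2∤a)
odd⇒^exponent-2^≋1 {a} 2∤a (suc (suc (suc j))) = go j
  where
  go : ∀ j → a ^ (2 * 2 ^ j) ≋ 1 [ 2 ^ (3 + j) ]
  go zero    = odd⇒^2≋1 2∤a
  go (suc j) = subst (_≋ 1 [ 2 ^ (4 + j) ])
    (trans (^-*-assoc a (2 * 2 ^ j) 2) (cong (a ^_) (*-comm (2 * 2 ^ j) 2))) (lift-≋1 prime[2] (2 + j) (go j))

-- Modulo 4, 3 ≡ -1 has order 2, so for m ≥ 3 the exponent is k = 2 k′. Powers of 3² = 1 + 8 are
-- then covered by `^≋1⇒prime-power∣` with s = 2, since 8 but not 16 divides 8.
3^≋1⇒exponent-2^∣ : ∀ m k → 3 ^ k ≋ 1 [ 2 ^ m ] → exponent-2^ m ∣ k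
3^≋1⇒exponent-2^∣ 0 k h = 1∣ k
3^≋1⇒exponent-2^∣ 1 k h = 1∣ k
3^≋1⇒exponent-2^∣ 2 k h with ∣prime-power prime[2] 0 (gcd[m,n]∣n k 2)
... | inj₁ g∣1 = contradiction (≋1⇒∣ (^≋1-∣ {a = 3} {gcd k 2} (^≋1-gcd {a = 3} {k} {2} h (congruent 0 2 refl)) g∣1)) (from-no (4 ∣? 2))
... | inj₂ g≡2 = subst (_∣ k) g≡2 (gcd[m,n]∣m k 2)
3^≋1⇒exponent-2^∣ (suc (suc (suc j))) k h
  with 3^≋1⇒exponent-2^∣ 2 k (≋-weaken (divides (2 ^ suc j) (lem (2 ^ j))) h)
  where
  lem : ∀ x → 2 * (2 * (2 * x)) ≡ 2 * x * 4
  lem = solve-∀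
... | divides k′ refl = subst (2 * 2 ^ j ∣_) (*-comm 2 k′) (*-monoʳ-∣ 2
  (^≋1⇒prime-power∣ prime[2] 2 good {8} (divides 1 refl) (from-no (16 ∣? 8)) j k′
    (subst (_≋ 1 [ 2 ^ (3 + j) ]) (trans (cong (3 ^_) (*-comm k′ 2)) (sym (^-*-assoc 3 2 k′))) h)))
  where
  good : ∀ {d} → 2 ^ 3 ∣ d → geo (suc d) 2 ≋ 2 [ 2 * 2 ]
  good (divides t refl) = congruent 0 (t * 2) (lem t)
    where
    lem : ∀ t → 1 + suc (t * 8) * (1 + suc (t * 8) * 0) + 0 ≡ 2 + t * 2 * 4
    lem = solve-∀

λ2^≡exponent-2^ : ∀ m → λ2^ m ≡ exponent-2^ m
λ2^≡exponent-2^ m = maxOrder-≡ {2 ^ m} {{m^n≢0 2 m}} (exponent-2^ m) 3 (>-nonZero⁻¹ _ {{exponent-2^-nonZero m}}) (below m) (units m)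
  (3^≋1⇒exponent-2^∣ m) (odd⇒^exponent-2^≋1 (from-no (2 ∣? 3)) m)
  where
  below : ∀ m → exponent-2^ m ≤ 2 ^ m
  below 0 = s≤s z≤n
  below 1 = s≤s z≤n
  below 2 = s≤s (s≤s z≤n)
  below (suc (suc (suc j))) = ^-monoʳ-≤ 2 (m≤n+m (suc j) 2)
  units : ∀ m (a : Fin (2 ^ m)) → IsUnit {{m^n≢0 2 m}} a → toℕ a ^ exponent-2^ m ≋ 1 [ 2 ^ m ]
  units zero    a _         = ≋-mod-1
  units (suc m) a (a′ , eq) = odd⇒^exponent-2^≋1
    (unit⇒∤ {a′ = toℕ a′} prime[2] (m∣m*n {2} (2 ^ m)) (unit⇒≋ {{m^n≢0 2 (suc m)}} {a} {a′} eq)) (suc m)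

-- Several primes at once

∑-cartesianProductWith : ∀ {A B C : Set} (f : A → B → C) xs ys (h : C → ℕ) →
                         ∑ (cartesianProductWith f xs ys) h ≡ ∑ xs (λ x → ∑ ys (λ y → h (f x y)))
∑-cartesianProductWith f []       ys h = refl
∑-cartesianProductWith f (x ∷ xs) ys h = trans (∑-++ (map (f x) ys) _ h)
  (cong₂ _+_ (∑-map (f x) ys h) (∑-cartesianProductWith f xs ys h))

-- e m plays the role of the exponent of the unit group modulo pᵐ, attained by root for all m at once.
record Local (p : ℕ) (e : ℕ → ℕ) : Set where
  field
    e-nonZero : ∀ m → NonZero (e m)
    exponent  : ∀ {a} → ¬ p ∣ a → ∀ m → a ^ e m ≋ 1 [ p ^ m ]
    root      : ℕ
    p∤root    : ¬ p ∣ root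
    sharp     : ∀ m k → root ^ k ≋ 1 [ p ^ m ] → e m ∣ k

open Local

local-odd : ∀ {p} → Prime p → ¬ 2 ∣ p → Local p (λ m → φ (p ^ m))
local-odd {zero}      pp 2∤p = contradiction pp ¬prime[0]
local-odd {p@(suc q)} pp 2∤p = record
  { e-nonZero = φ-nonZero
  ; exponent  = λ { p∤a zero → ≋-mod-1 ; p∤a (suc m) → euler pp p∤a m }
  ; root      = proj₁ (primitive-root pp 2∤p)
  ; p∤root    = proj₁ (proj₂ (primitive-root pp 2∤p))
  ; sharp     = proj₂ (proj₂ (primitive-root pp 2∤p))
  }
  where
  φ-nonZero : ∀ m → NonZero (φ (p ^ m))
  φ-nonZero zero    = _
  φ-nonZero (suc m) = subst NonZero (sym (φ-value pp m)) (m*n≢0 q (p ^ m) {{≢-nonZero λ { refl → ¬prime[1] pp }}} {{m^n≢0 p m}})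

local-2 : Local 2 λ2^
local-2 = record
  { e-nonZero = λ m → subst NonZero (sym (λ2^≡exponent-2^ m)) (exponent-2^-nonZero m)
  ; exponent  = λ {a} 2∤a m → subst (λ e → a ^ e ≋ 1 [ 2 ^ m ]) (sym (λ2^≡exponent-2^ m)) (odd⇒^exponent-2^≋1 2∤a m)
  ; root      = 3
  ; p∤root    = from-no (2 ∣? 3)
  ; sharp     = λ m k h → subst (_∣ k) (sym (λ2^≡exponent-2^ m)) (3^≋1⇒exponent-2^∣ m k h)
  }

-- Kept componentwise, so that its indicator factors along the vector and each component meets its
-- own local exponent.
Divs : ∀ {r} → Vec ℕ r → Vec ℕ r → ℕ → Set
Divs []       []       c = ⊤
Divs (p ∷ ps) (m ∷ ms) c = p ^ m ∣ c × Divs ps ms c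

divs? : ∀ {r} (ps ms : Vec ℕ r) c → Dec (Divs ps ms c)
divs? []       []       c = yes tt
divs? (p ∷ ps) (m ∷ ms) c = (p ^ m ∣? c) ×-dec divs? ps ms c

prod-^ : ∀ {r} → Vec ℕ r → Vec ℕ r → ℕ
prod-^ ps ks = ∏ (zipWith _^_ ps ks)

prime∤prod-^ : ∀ {r p} {ps : Vec ℕ r} → Prime p → All (p ≢_) ps → All Prime ps → ∀ ks → ¬ p ∣ prod-^ ps ks
prime∤prod-^ pp []       []        []       p∣1 = contradiction (∣1⇒≡1 p∣1) λ { refl → ¬prime[1] pp }
prime∤prod-^ {p = p} {l ∷ ps} pp (p≢l ∷ p≢) (pl ∷ pps) (k ∷ ks) h =
  [ (λ p∣l^k → [ (λ { refl → ¬prime[1] pp }) , p≢l ]′ (prime⇒irreducible pl (prime∣^⇒∣ pp k p∣l^k)))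
  , prime∤prod-^ pp p≢ pps ks ]′ (euclidsLemma (l ^ k) (prod-^ ps ks) pp h)

coprime-prod-^ : ∀ {r p} {ps : Vec ℕ r} → Prime p → All (p ≢_) ps → All Prime ps → ∀ k ks → Coprime (p ^ k) (prod-^ ps ks)
coprime-prod-^ pp p≢ pps k ks = coprime-^ˡ (prime∤⇒coprime pp (prime∤prod-^ pp p≢ pps ks)) k

prod-^-nonZero : ∀ {r} {ps : Vec ℕ r} → All Prime ps → ∀ ks → NonZero (prod-^ ps ks)
prod-^-nonZero []         []       = _
prod-^-nonZero (pp ∷ pps) (k ∷ ks) = m*n≢0 _ _ {{m^n≢0 _ k {{prime⇒nonZero pp}}}} {{prod-^-nonZero pps ks}}

divs⇒∣ : ∀ {r} {ps : Vec ℕ r} → All Prime ps → Unique ps → ∀ ks {c} → Divs ps ks c → prod-^ ps ks ∣ c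
divs⇒∣ []         []         []       _         = 1∣ _
divs⇒∣ (pp ∷ pps) (p≢ ∷ uniq) (k ∷ ks) (h , hs) = coprime-*-∣ (coprime-prod-^ pp p≢ pps k ks) h (divs⇒∣ pps uniq ks hs)

gcd-box : ∀ {r} {ps : Vec ℕ r} → All Prime ps → Unique ps → ∀ ks c →
          gcd c (prod-^ ps ks) ≡ ∑ (box ks) (λ ms → ∏ (φ^ ps ms) * 𝟙 (divs? ps ms c))
gcd-box []         []          []       c = gcd-zeroʳ c
gcd-box {ps = p ∷ ps} (pp ∷ pps) (p≢ ∷ uniq) (k ∷ ks) c = begin
  gcd c (p ^ k * prod-^ ps ks)                                                      ≡⟨ gcd-*-coprime c (coprime-prod-^ pp p≢ pps k ks) ⟩
  gcd c (p ^ k) * gcd c (prod-^ ps ks)                                              ≡⟨ cong₂ _*_ (gcd-prime-power pp c k) (gcd-box pps uniq ks c) ⟩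
  ∑ ms₀ f * ∑ (box ks) g                                                            ≡⟨ ∑-*ʳ ms₀ (∑ (box ks) g) f ⟨
  ∑ ms₀ (λ m → f m * ∑ (box ks) g)                                                  ≡⟨ ∑-cong ms₀ (λ m → sym (∑-*ˡ (box ks) (f m) g)) ⟩
  ∑ ms₀ (λ m → ∑ (box ks) (λ ms → f m * g ms))                                      ≡⟨ ∑-cong ms₀ (λ m → ∑-cong (box ks) (λ ms → merge m ms)) ⟩
  ∑ ms₀ (λ m → ∑ (box ks) (λ ms → h (m ∷ ms)))                                      ≡⟨ ∑-cartesianProductWith _∷_ ms₀ (box ks) h ⟨
  ∑ (box (k ∷ ks)) h                                                                ∎
  where
  open ≡-Reasoning
  ms₀ = upTo (suc k)
  f : ℕ → ℕ
  f m = φ (p ^ m) * 𝟙 (p ^ m ∣? c)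
  g : Vec ℕ _ → ℕ
  g ms = ∏ (φ^ ps ms) * 𝟙 (divs? ps ms c)
  h : Vec ℕ _ → ℕ
  h ms = ∏ (φ^ (p ∷ ps) ms) * 𝟙 (divs? (p ∷ ps) ms c)
  merge : ∀ m ms → f m * g ms ≡ h (m ∷ ms)
  merge m ms = trans (*-interchange (φ (p ^ m)) (𝟙 (p ^ m ∣? c)) (∏ (φ^ ps ms)) (𝟙 (divs? ps ms c)))
    (cong (φ (p ^ m) * ∏ (φ^ ps ms) *_) (sym (𝟙-× (p ^ m ∣? c) (divs? ps ms c))))

period : ∀ {r} → Vec (ℕ → ℕ) r → Vec ℕ r → ℕ
period es ms = lcms (toList (zipWith _$_ es ms))

∈box-∷⁻ : ∀ {r} k (ks : Vec ℕ r) {m ms} → m ∷ ms ∈ box (k ∷ ks) → m ≤ k × ms ∈ box ks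
∈box-∷⁻ k ks h with ∈-cartesianProductWith⁻ _∷_ (upTo (suc k)) (box ks) h
... | _ , _ , m∈ , ms∈ , refl = s≤s⁻¹ (∈-upTo⁻ m∈) , ms∈

ks∈box : ∀ {r} (ks : Vec ℕ r) → ks ∈ box ks
ks∈box []       = here refl
ks∈box (k ∷ ks) = ∈-cartesianProductWith⁺ _∷_ (∈-upTo⁺ (n<1+n k)) (ks∈box ks)

period-nonZero : ∀ {r} {ps : Vec ℕ r} {es : Vec (ℕ → ℕ) r} → Pointwise Local ps es → ∀ ms → NonZero (period es ms)
period-nonZero []       []       = _
period-nonZero {es = e ∷ es} (l ∷ ls) (m ∷ ms) = ≢-nonZero λ lcm≡0 →
  ≢-nonZero⁻¹ (e m * period es ms) {{m*n≢0 _ _ {{e-nonZero l m}} {{period-nonZero ls ms}}}}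
    (trans (sym (gcd*lcm (e m) (period es ms))) (trans (cong (gcd (e m) (period es ms) *_) lcm≡0) (*-zeroʳ (gcd (e m) (period es ms)))))

-- The guard `1 ≤ k` matters for the prime 2, which is listed even when n is odd: a unit modulo an
-- odd number may be even.
UnitAt : ∀ {r} → Vec ℕ r → Vec ℕ r → ℕ → Set
UnitAt []       []       a = ⊤
UnitAt (p ∷ ps) (k ∷ ks) a = (1 ≤ k → ¬ p ∣ a) × UnitAt ps ks a

∣period⇒divs : ∀ {r} {ps : Vec ℕ r} {es : Vec (ℕ → ℕ) r} → Pointwise Local ps es → ∀ {ks ms d k} → ms ∈ box ks → UnitAt ps ks (suc d) →
               period es ms ∣ k → Divs ps ms (d * geo (suc d) k)
∣period⇒divs [] {[]} {[]} _ _ _ = tt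
∣period⇒divs {ps = p ∷ ps} {es = e ∷ es} (l ∷ ls) {k₁ ∷ ks} {m ∷ ms} {d} {k} ms∈ (u , us) h with ∈box-∷⁻ k₁ ks ms∈
... | m≤k , ms∈′ = first m m≤k (∣-trans (m∣lcm[m,n] (e m) (period es ms)) h) ,
                   ∣period⇒divs ls ms∈′ us (∣-trans (n∣lcm[m,n] (e m) (period es ms)) h)
  where
  first : ∀ m → m ≤ k₁ → e m ∣ k → p ^ m ∣ d * geo (suc d) k
  first zero    _   _  = 1∣ _
  first (suc m) m≤k h′ = ≋1⇒∣ (subst (_≋ 1 [ p ^ suc m ]) (^≡1+geo d k)
    (^≋1-∣ {a = suc d} {e (suc m)} (exponent l (u (≤-trans (s≤s z≤n) m≤k)) (suc m)) h′))

RootAt : ∀ {r} {ps : Vec ℕ r} {es : Vec (ℕ → ℕ) r} → Pointwise Local ps es → Vec ℕ r → ℕ → Set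
RootAt             []       []       a = ⊤
RootAt {ps = p ∷ _} (l ∷ ls) (k ∷ ks) a = a ≋ root l [ p ^ k ] × RootAt ls ks a

root⇒unit : ∀ {r} {ps : Vec ℕ r} {es : Vec (ℕ → ℕ) r} (ls : Pointwise Local ps es) ks {a} → RootAt ls ks a → UnitAt ps ks a
root⇒unit []       []       _        = tt
root⇒unit {ps = p ∷ _} (l ∷ ls) (k ∷ ks) {a} (h , hs) = first k h , root⇒unit ls ks hs
  where
  first : ∀ k → a ≋ root l [ p ^ k ] → 1 ≤ k → ¬ p ∣ a
  first (suc k) h _ p∣a = p∤root l (≋-∣ (≋-weaken (m∣m*n (p ^ k)) h) p∣a)

-- A congruence with the root modulo pᵏ persists modulo pᵐ for m ≤ k, where the same root is still
-- sharp.
divs⇒∣period : ∀ {r} {ps : Vec ℕ r} {es : Vec (ℕ → ℕ) r} (ls : Pointwise Local ps es) {ks ms d k} → ms ∈ box ks → RootAt ls ks (suc d) →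
               Divs ps ms (d * geo (suc d) k) → period es ms ∣ k
divs⇒∣period [] {[]} {[]} _ _ _ = 1∣ _
divs⇒∣period {ps = p ∷ ps} (l ∷ ls) {k₁ ∷ ks} {m ∷ ms} {d} {k} ms∈ (r , rs) (h , hs) with ∈box-∷⁻ k₁ ks ms∈
... | m≤k , ms∈′ = lcm-least
  (sharp l m k (≋-trans (≋-^ (≋-sym (≋-weaken (^-mono-∣ p m≤k) r)) k) (subst (_≋ 1 [ p ^ m ]) (sym (^≡1+geo d k)) (∣⇒≋1 h))))
  (divs⇒∣period ls ms∈′ rs hs)

chinese-remainder : ∀ {m n} .{{_ : NonZero m}} .{{_ : NonZero n}} → Coprime m n → ∀ a b → ∃[ z ] (z ≋ a [ m ] × z ≋ b [ n ])
chinese-remainder {m} {n} cop a b with coprime-inverse {m} {n} cop | coprime-inverse {n} {m} (Coprimality.sym cop)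
... | n′ , nn′≋1 | m′ , mm′≋1 = a * (n * n′) + b * (m * m′)
  , ≋-trans (≋-+ (≋-* (≋-refl {a = a}) nn′≋1) (∣⇒≋0 (∣n⇒∣m*n b (m∣m*n m′)))) (≋-reflexive (trans (+-identityʳ _) (*-identityʳ a)))
  , ≋-trans (≋-+ (∣⇒≋0 (∣n⇒∣m*n a (m∣m*n n′))) (≋-* (≋-refl {a = b}) mm′≋1)) (≋-reflexive (*-identityʳ b))

rootAt-≋ : ∀ {r} {ps : Vec ℕ r} {es : Vec (ℕ → ℕ) r} (ls : Pointwise Local ps es) ks {a b} → a ≋ b [ prod-^ ps ks ] → RootAt ls ks b → RootAt ls ks a
rootAt-≋ []       []       _ _        = tt
rootAt-≋ {ps = p ∷ ps} (l ∷ ls) (k ∷ ks) h (r , rs) =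
  ≋-trans (≋-weaken (m∣m*n (prod-^ ps ks)) h) r , rootAt-≋ ls ks (≋-weaken (n∣m*n (p ^ k)) h) rs

common-root : ∀ {r} {ps : Vec ℕ r} {es : Vec (ℕ → ℕ) r} (ls : Pointwise Local ps es) → All Prime ps → Unique ps → ∀ ks → ∃[ a ] RootAt ls ks a
common-root []       []         []          []       = 0 , tt
common-root {ps = p ∷ ps} (l ∷ ls) (pp ∷ pps) (p≢ ∷ uniq) (k ∷ ks) =
  let b , hb = common-root ls pps uniq ks
      a , a≋root , a≋b = chinese-remainder {{m^n≢0 p k {{prime⇒nonZero pp}}}} {{prod-^-nonZero pps ks}}
                           (coprime-prod-^ pp p≢ pps k ks) (root l) b
  in a , a≋root , rootAt-≋ ls ks a≋b hb

∣⇒unitAt : ∀ {r} {ps : Vec ℕ r} → All Prime ps → ∀ ks {n a a′} → prod-^ ps ks ∣ n → a * a′ ≋ 1 [ n ] → UnitAt ps ks a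
∣⇒unitAt []         []       _ _ = tt
∣⇒unitAt {ps = p ∷ ps} (pp ∷ pps) (k ∷ ks) {n} {a} {a′} h u =
  first k (∣-trans (m∣m*n (prod-^ ps ks)) h) , ∣⇒unitAt pps ks {a′ = a′} (∣-trans (n∣m*n (p ^ k)) h) u
  where
  first : ∀ k → p ^ k ∣ n → 1 ≤ k → ¬ p ∣ a
  first (suc k) h′ _ = unit⇒∤ {a′ = a′} pp (∣-trans (m∣m*n (p ^ k)) h′) u

-- Extremal affine permutations

cyc≤n : ∀ {n} (π : Permutation′ n) → cyc π ≤ n
cyc≤n {n} π = ≤-trans (length-deduplicate _ (map (cycleOf π) (allFin n)))
  (≤-reflexive (trans (length-map (cycleOf π) (allFin n)) (length-tabulate {n = n} (λ i → i))))

module _ {n : ℕ} .{{_ : NonZero n}} where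

  toℕ-+ₙ : ∀ (x y : Fin n) → toℕ (x +ₙ y) ≋ toℕ x + toℕ y [ n ]
  toℕ-+ₙ x y = toℕ-mod-≋ (toℕ x + toℕ y)

  toℕ-*ₙ : ∀ (x y : Fin n) → toℕ (x *ₙ y) ≋ toℕ x * toℕ y [ n ]
  toℕ-*ₙ x y = toℕ-mod-≋ (toℕ x * toℕ y)

  toℕ--ₙ : ∀ (x : Fin n) → toℕ (-ₙ x) + toℕ x ≋ 0 [ n ]
  toℕ--ₙ x = ≋-trans (≋-+ (toℕ-mod-≋ (n ∸ toℕ x)) ≋-refl)
    (≋-trans (≋-reflexive (m∸n+n≡m (<⇒≤ (toℕ<n x)))) (∣⇒≋0 ∣-refl))

module _ {r : ℕ} {ps : Vec ℕ r} {es : Vec (ℕ → ℕ) r} (ls : Pointwise Local ps es)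
         (pps : All Prime ps) (uniq : Unique ps) (ks : Vec ℕ r) where

  private
    n : ℕ
    n = prod-^ ps ks

    instance
      n≢0 : NonZero n
      n≢0 = prod-^-nonZero pps ks

  -- A common multiple of all the L(m); as a product over the box it is divisible by each of them at
  -- sight.
  commonPeriod : ℕ
  commonPeriod = product (map (period es) (box ks))

  private
    M N : ℕ
    M = commonPeriod
    N = n * M

  commonPeriod-nonZero : NonZero M
  commonPeriod-nonZero = product≢0 (ListAll.tabulate λ o∈ → helper (∈-map⁻ (period es) o∈))
    where
    helper : ∀ {o} → (∃[ ms ] (ms ∈ box ks × o ≡ period es ms)) → NonZero o
    helper (ms , _ , refl) = period-nonZero ls ms

  period∣commonPeriod : ∀ {ms} → ms ∈ box ks → period es ms ∣ M
  period∣commonPeriod ms∈ = ∈⇒∣product (∈-map⁺ (period es) ms∈)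

  N-nonZero : NonZero N
  N-nonZero = m*n≢0 n M {{n≢0}} {{commonPeriod-nonZero}}

  -- The quotient N / L(m), kept as a count so that it can be compared term by term with the
  -- indicator of `Divs`.
  multiples : Vec ℕ r → ℕ
  multiples ms = ∑ (upTo N) (λ k → 𝟙 (period es ms ∣? k))

  multiples*period : ∀ {ms} → ms ∈ box ks → multiples ms * period es ms ≡ N
  multiples*period {ms} ms∈ = count (∣n⇒∣m*n n (period∣commonPeriod ms∈))
    where
    count : ∀ {N} → period es ms ∣ N → ∑ (upTo N) (λ k → 𝟙 (period es ms ∣? k)) * period es ms ≡ N
    count (divides q refl) = cong (_* period es ms) (count-multiples q (period es ms) {{period-nonZero ls ms}})

  -- N times the sum in the theorem.
  cycleCount : ℕ
  cycleCount = ∑ (box ks) (λ ms → ∏ (φ^ ps ms) * multiples ms)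

  unitAt⇒^M≋1 : ∀ {d} → UnitAt ps ks (suc d) → suc d ^ M ≋ 1 [ n ]
  unitAt⇒^M≋1 {d} u = ≋-trans (≋-reflexive (^≡1+geo d M))
    (∣⇒≋1 (divs⇒∣ pps uniq ks (∣period⇒divs ls (ks∈box ks) u (period∣commonPeriod (ks∈box ks)))))

  ∑-gcd : ∀ d → ∑ (upTo N) (λ k → gcd (d * geo (suc d) k) n) ≡
                ∑ (box ks) (λ ms → ∏ (φ^ ps ms) * ∑ (upTo N) (λ k → 𝟙 (divs? ps ms (d * geo (suc d) k))))
  ∑-gcd d = begin
    ∑ (upTo N) (λ k → gcd (c k) n)                                                        ≡⟨ ∑-cong (upTo N) (λ k → gcd-box pps uniq ks (c k)) ⟩
    ∑ (upTo N) (λ k → ∑ (box ks) (λ ms → ∏ (φ^ ps ms) * 𝟙 (divs? ps ms (c k))))           ≡⟨ ∑-swap (upTo N) (box ks) (λ k ms → ∏ (φ^ ps ms) * 𝟙 (divs? ps ms (c k))) ⟩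
    ∑ (box ks) (λ ms → ∑ (upTo N) (λ k → ∏ (φ^ ps ms) * 𝟙 (divs? ps ms (c k))))           ≡⟨ ∑-cong (box ks) (λ ms → ∑-*ˡ (upTo N) (∏ (φ^ ps ms)) (λ k → 𝟙 (divs? ps ms (c k)))) ⟩
    ∑ (box ks) (λ ms → ∏ (φ^ ps ms) * ∑ (upTo N) (λ k → 𝟙 (divs? ps ms (c k))))           ∎
    where
    open ≡-Reasoning
    c : ℕ → ℕ
    c k = d * geo (suc d) k

  unitAt⇒cycleCount≤ : ∀ {d} → UnitAt ps ks (suc d) → cycleCount ≤ ∑ (upTo N) (λ k → gcd (d * geo (suc d) k) n)
  unitAt⇒cycleCount≤ {d} u = ≤-trans
    (∑-mono (box ks) λ {ms} ms∈ → *-monoʳ-≤ (∏ (φ^ ps ms)) (∑-mono (upTo N) λ {k} _ →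
      𝟙-mono (period es ms ∣? k) (divs? ps ms (d * geo (suc d) k)) (∣period⇒divs ls ms∈ u)))
    (≤-reflexive (sym (∑-gcd d)))

  rootAt⇒cycleCount≡ : ∀ {d} → RootAt ls ks (suc d) → ∑ (upTo N) (λ k → gcd (d * geo (suc d) k) n) ≡ cycleCount
  rootAt⇒cycleCount≡ {d} ra = trans (∑-gcd d)
    (∑-cong-∈ (box ks) λ {ms} ms∈ → cong (∏ (φ^ ps ms) *_) (∑-cong (upTo N) λ k →
      𝟙-cong (divs? ps ms (d * geo (suc d) k)) (period es ms ∣? k)
        (divs⇒∣period ls ms∈ ra) (∣period⇒divs ls ms∈ (root⇒unit ls ks ra))))

  -- Some translate of x ↦ a x + b is the linear map x ↦ a x.
  affine⇒many-cycles : ∀ π → IsAffine {n} π → ∃[ β ] cycleCount ≤ N * cyc (translation β ∘ₚ π)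
  affine⇒many-cycles π (a , b , (a′ , aa′≡1) , π≡) = β ,
    ≤-trans (unitAt⇒cycleCount≤ u) (≤-reflexive (sym (cyc-linear (translation β ∘ₚ π) d M σ-linear (unitAt⇒^M≋1 u))))
    where
    open ≋-Reasoning n
    -- Adding `n` makes the representative positive, so that it has the form `suc d`; for n = 1 the
    -- residue itself is 0.
    A = toℕ a + n
    d = pred A
    A≡ : suc d ≡ A
    A≡ = suc-pred A {{≢-nonZero λ A≡0 → ≢-nonZero⁻¹ n (m+n≡0⇒n≡0 (toℕ a) A≡0)}}
    A≋a : suc d ≋ toℕ a [ n ]
    A≋a = ≋-trans (≋-reflexive A≡) (≋-trans (≋-+ ≋-refl (∣⇒≋0 ∣-refl)) (≋-reflexive (+-identityʳ (toℕ a))))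
    u : UnitAt ps ks (suc d)
    u = ∣⇒unitAt pps ks {a′ = toℕ a′} ∣-refl (≋-trans (≋-* A≋a ≋-refl) (unit⇒≋ {a = a} {a′} aa′≡1))
    β = a′ *ₙ (-ₙ b)
    aβ+b : toℕ a * toℕ β + toℕ b ≋ 0 [ n ]
    aβ+b = begin
      toℕ a * toℕ β + toℕ b                          ≈⟨ ≋-+ (≋-* (≋-refl {a = toℕ a}) (toℕ-*ₙ a′ (-ₙ b))) ≋-refl ⟩
      toℕ a * (toℕ a′ * toℕ (-ₙ b)) + toℕ b          ≡⟨ cong (_+ toℕ b) (*-assoc (toℕ a) (toℕ a′) (toℕ (-ₙ b))) ⟨
      toℕ a * toℕ a′ * toℕ (-ₙ b) + toℕ b            ≈⟨ ≋-+ (≋-* (unit⇒≋ {a = a} {a′} aa′≡1) ≋-refl) ≋-refl ⟩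
      1 * toℕ (-ₙ b) + toℕ b                         ≡⟨ cong (_+ toℕ b) (*-identityˡ (toℕ (-ₙ b))) ⟩
      toℕ (-ₙ b) + toℕ b                             ≈⟨ toℕ--ₙ b ⟩
      0                                              ∎
    σ-linear : ∀ x → toℕ ((translation β ∘ₚ π) ⟨$⟩ʳ x) ≋ suc d * toℕ x [ n ]
    σ-linear x = begin
      toℕ (π ⟨$⟩ʳ (x +ₙ β))                          ≡⟨ cong toℕ (π≡ (x +ₙ β)) ⟩
      toℕ (a *ₙ (x +ₙ β) +ₙ b)                       ≈⟨ toℕ-+ₙ (a *ₙ (x +ₙ β)) b ⟩
      toℕ (a *ₙ (x +ₙ β)) + toℕ b                    ≈⟨ ≋-+ (toℕ-*ₙ a (x +ₙ β)) ≋-refl ⟩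
      toℕ a * toℕ (x +ₙ β) + toℕ b                   ≈⟨ ≋-+ (≋-* (≋-refl {a = toℕ a}) (toℕ-+ₙ x β)) ≋-refl ⟩
      toℕ a * (toℕ x + toℕ β) + toℕ b                ≡⟨ lem (toℕ a) (toℕ x) (toℕ β) (toℕ b) ⟩
      toℕ a * toℕ x + (toℕ a * toℕ β + toℕ b)        ≈⟨ ≋-+ (≋-* (≋-sym A≋a) ≋-refl) aβ+b ⟩
      suc d * toℕ x + 0                              ≡⟨ +-identityʳ _ ⟩
      suc d * toℕ x                                  ∎
      where
      lem : ∀ a x β b → a * (x + β) + b ≡ a * x + (a * β + b)
      lem = solve-∀

  -- The witness is multiplication by a common root. Its translates x ↦ a (x + β) are affine with
  -- constant term a β, so `cyc-affine-≤` bounds their cycles by those of the linear map.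
  extremal : ∃[ π ] (IsAffine {n} π × N * cyc π ≡ cycleCount × ∀ β → cyc (translation β ∘ₚ π) ≤ cyc π)
  extremal = π , (suc d mod n , 0 mod n , ≋⇒unit (suc d) a′ aa′≋1 , π-affine) , count , λ β →
    *-cancelˡ-≤ N {{N-nonZero}} (≤-trans (cyc-affine-≤ (translation β ∘ₚ π) d (suc d * toℕ β) M (σ-affine β) ^M≋1)
      (≤-reflexive (trans (rootAt⇒cycleCount≡ ra) (sym count))))
    where
    open ≋-Reasoning n
    a = proj₁ (common-root ls pps uniq ks)
    d = pred (a + n)
    ra : RootAt ls ks (suc d)
    ra = rootAt-≋ ls ks
      (≋-trans (≋-reflexive (suc-pred (a + n) {{≢-nonZero λ A≡0 → ≢-nonZero⁻¹ n (m+n≡0⇒n≡0 a A≡0)}}))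
        (≋-trans (≋-+ ≋-refl (∣⇒≋0 ∣-refl)) (≋-reflexive (+-identityʳ a))))
      (proj₂ (common-root ls pps uniq ks))
    ^M≋1 : suc d ^ M ≋ 1 [ n ]
    ^M≋1 = unitAt⇒^M≋1 (root⇒unit ls ks ra)
    a′ = suc d ^ pred M
    aa′≋1 : suc d * a′ ≋ 1 [ n ]
    aa′≋1 = ≋-trans (≋-reflexive (cong (suc d ^_) (suc-pred M {{commonPeriod-nonZero}}))) ^M≋1
    π = linear {n} (suc d) a′ aa′≋1
    π-linear : ∀ x → toℕ (π ⟨$⟩ʳ x) ≋ suc d * toℕ x [ n ]
    π-linear x = toℕ-mod-≋ (suc d * toℕ x)
    count : N * cyc π ≡ cycleCount
    count = trans (cyc-linear π d M π-linear ^M≋1) (rootAt⇒cycleCount≡ ra)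
    π-affine : ∀ x → π ⟨$⟩ʳ x ≡ (suc d mod n) *ₙ x +ₙ (0 mod n)
    π-affine x = toℕ-≋-injective (≋-sym (begin
      toℕ ((suc d mod n) *ₙ x +ₙ (0 mod n))            ≈⟨ toℕ-+ₙ ((suc d mod n) *ₙ x) (0 mod n) ⟩
      toℕ ((suc d mod n) *ₙ x) + toℕ (0 mod n)         ≈⟨ ≋-+ (toℕ-*ₙ (suc d mod n) x) (toℕ-mod-≋ 0) ⟩
      toℕ (suc d mod n) * toℕ x + 0                    ≡⟨ +-identityʳ _ ⟩
      toℕ (suc d mod n) * toℕ x                        ≈⟨ ≋-* (toℕ-mod-≋ (suc d)) ≋-refl ⟩
      suc d * toℕ x                                    ≈⟨ π-linear x ⟨
      toℕ (π ⟨$⟩ʳ x)                                   ∎))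
    σ-affine : ∀ β x → toℕ ((translation β ∘ₚ π) ⟨$⟩ʳ x) ≋ suc d * toℕ x + suc d * toℕ β [ n ]
    σ-affine β x = begin
      toℕ (π ⟨$⟩ʳ (x +ₙ β))            ≈⟨ π-linear (x +ₙ β) ⟩
      suc d * toℕ (x +ₙ β)             ≈⟨ ≋-* (≋-refl {a = suc d}) (toℕ-+ₙ x β) ⟩
      suc d * (toℕ x + toℕ β)          ≡⟨ *-distribˡ-+ (suc d) (toℕ x) (toℕ β) ⟩
      suc d * toℕ x + suc d * toℕ β    ∎

  -- In its own class `π` has the most cycles, so it realises the minimum of `t`. Every other affine
  -- class contains a map with at least as many cycles as `π`, which caps the minimum of that class.
  extremal⇒tAff : ∀ π → IsAffine {n} π → N * cyc π ≡ cycleCount → (∀ β → cyc (translation β ∘ₚ π) ≤ cyc π) →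
                  IsTAff n (n ∸ cyc π)
  extremal⇒tAff π aff count translates = (π , aff , attained) , bound
    where
    attained : t[ π ] ≡ t π
    attained = ≤-antisym (min≤⊤ (t π) (map t (class π))) (v≤min⁺ ≤-refl (ListAll.tabulate λ w∈ → above (∈-map⁻ t w∈)))
      where
      above : ∀ {w} → (∃[ σ ] (σ ∈ class π × w ≡ t σ)) → t π ≤ w
      above (σ , σ∈ , refl) =
        let β , _ , σ≡ = ∈-map⁻ (λ b → translation b ∘ₚ π) σ∈
        in subst (λ σ → t π ≤ t σ) (sym σ≡) (∸-monoʳ-≤ n (translates β))
    bound : ∀ w → (∃[ σ ] (IsAffine {n} σ × t[ σ ] ≡ w)) → w ≤ n ∸ cyc π
    bound _ (σ , aff-σ , refl) =
      let β , many = affine⇒many-cycles σ aff-σ in ≤-trans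
      (ListAll.lookup (min≤xs (t σ) (map t (class σ))) (∈-map⁺ t (∈-map⁺ (λ b → translation b ∘ₚ σ) (∈-allFin β))))
      (∸-monoʳ-≤ n (*-cancelˡ-≤ N {{N-nonZero}} (≤-trans (≤-reflexive count) many)))

  tAff : ∃[ c ] (c ≤ n × N * c ≡ cycleCount × IsTAff n (n ∸ c))
  tAff = let π , aff , count , translates = extremal
         in cyc π , cyc≤n π , count , extremal⇒tAff π aff count translates

-- Rational sums

÷-≡ : ∀ {a b c d} .{{_ : NonZero c}} .{{_ : NonZero d}} → a * d ≡ b * c → a ÷ c ≡ b ÷ d
÷-≡ {a} {b} {suc c} {suc d} eq = ℚ.fromℚᵘ-cong {mkℚᵘ (pos a) c} {mkℚᵘ (pos b) d}
  (*≡* (trans (sym (ℤ.pos-* a (suc d))) (trans (cong pos eq) (ℤ.pos-* b (suc c)))))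

÷-+ : ∀ a b N .{{_ : NonZero N}} → a ÷ N +ℚ b ÷ N ≡ (a + b) ÷ N
÷-+ a b (suc N) = ℚ.toℚᵘ-injective (begin
  toℚᵘ (a ÷ suc N +ℚ b ÷ suc N)               ≈⟨ ℚ.toℚᵘ-homo-+ (a ÷ suc N) (b ÷ suc N) ⟩
  toℚᵘ (a ÷ suc N) ℚᵘ.+ toℚᵘ (b ÷ suc N)      ≈⟨ ℚᵘ.+-cong (ℚ.toℚᵘ-fromℚᵘ (mkℚᵘ (pos a) N)) (ℚ.toℚᵘ-fromℚᵘ (mkℚᵘ (pos b) N)) ⟩
  mkℚᵘ (pos a) N ℚᵘ.+ mkℚᵘ (pos b) N          ≈⟨ *≡* (trans (cong (ℤ._* pos (suc N)) numerator) (trans (sym (ℤ.pos-* (a * suc N + b * suc N) (suc N))) (trans (cong pos (lem a b (suc N))) (ℤ.pos-* (a + b) (suc N * suc N))))) ⟩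
  mkℚᵘ (pos (a + b)) N                        ≈⟨ ℚ.toℚᵘ-fromℚᵘ (mkℚᵘ (pos (a + b)) N) ⟨
  toℚᵘ ((a + b) ÷ suc N)                      ∎)
  where
  open ℚᵘ.≃-Reasoning
  numerator : pos a ℤ.* pos (suc N) ℤ.+ pos b ℤ.* pos (suc N) ≡ pos (a * suc N + b * suc N)
  numerator = cong₂ ℤ._+_ (sym (ℤ.pos-* a (suc N))) (sym (ℤ.pos-* b (suc N)))
  lem : ∀ a b N → (a * N + b * N) * N ≡ (a + b) * (N * N)
  lem = solve-∀

-- All fractions are brought to the common denominator `N`, with `quot x` as the expanding factor.
sumℚ-÷ : ∀ {A : Set} (num den quot : A → ℕ) N .{{_ : NonZero N}} xs → (∀ {x} → x ∈ xs → quot x * den x ≡ N) →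
         sumℚ (map (λ x → num x ÷ den x) xs) ≡ ∑ xs (λ x → num x * quot x) ÷ N
sumℚ-÷ num den quot N []       eq = ÷-≡ {0} {0} {1} {N} refl
sumℚ-÷ num den quot N (x ∷ xs) eq = trans
  (cong₂ _+ℚ_ (÷-≡ {{den≢0}} cross) (sumℚ-÷ num den quot N xs (eq ∘ there)))
  (÷-+ (num x * quot x) (∑ xs (λ x → num x * quot x)) N)
  where
  den≢0 : NonZero (den x)
  den≢0 = ≢-nonZero λ d≡0 → ≢-nonZero⁻¹ N (trans (sym (eq (here refl))) (trans (cong (quot x *_) d≡0) (*-zeroʳ (quot x))))
  cross : num x * N ≡ num x * quot x * den x
  cross = trans (cong (num x *_) (sym (eq (here refl)))) (sym (*-assoc (num x) (quot x) (den x)))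

odd-locals : ∀ {r} {ps : Vec ℕ r} → All Prime ps → All (λ p → ¬ 2 ∣ p) ps → Pointwise Local ps (Vec.map (λ p m → φ (p ^ m)) ps)
odd-locals []         []         = []
odd-locals (pp ∷ pps) (2∤p ∷ odd) = local-odd pp 2∤p ∷ odd-locals pps odd

theorem3p4 : (n : ℕ) .{{_ : NonZero n}} (r k₀ : ℕ) (ps ks : Vec ℕ r) →
    All Prime ps → All (λ p → ¬ (2 ∣ p)) ps → Unique ps → All (1 ≤_) ks →
    n ≡ 2 ^ k₀ * ∏ (zipWith _^_ ps ks) →
    ∃[ v ] (IsTAff n v × v ÷ 1 ≡ n ÷ 1 - cycleSum k₀ ps ks)
theorem3p4 n r k₀ ps ks pps odd uniq _ refl =
  let c , c≤n , count , isTAff = tAff ls pps′ uniq′ (k₀ ∷ ks)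
  in n ∸ c , isTAff , trans (complement c c≤n) (cong (λ q → n ÷ 1 - q) (cycleSum≡ c count))
  where
  es = Vec.map (λ p m → φ (p ^ m)) ps
  -- The prime 2 is one more entry of the list, with λ in place of φ as its exponent; for k₀ = 0 it
  -- contributes only m₀ = 0.
  ls : Pointwise Local (2 ∷ ps) (λ2^ ∷ es)
  ls = local-2 ∷ odd-locals pps odd
  pps′ : All Prime (2 ∷ ps)
  pps′ = prime[2] ∷ pps
  uniq′ : Unique (2 ∷ ps)
  uniq′ = All.map (λ 2∤p → λ { refl → 2∤p ∣-refl }) odd ∷ uniq
  N = n * commonPeriod ls pps′ uniq′ (k₀ ∷ ks)
  instance
    N≢0 : NonZero N
    N≢0 = N-nonZero ls pps′ uniq′ (k₀ ∷ ks)
  num den quot : ℕ × Vec ℕ r → ℕ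
  num (m₀ , ms) = φ (2 ^ m₀) * ∏ (φ^ ps ms)
  den (m₀ , ms) = lcms (λ2^ m₀ ∷ toList (φ^ ps ms))
  quot (m₀ , ms) = multiples ls pps′ uniq′ (k₀ ∷ ks) (m₀ ∷ ms)
  quot*den : ∀ {x} → x ∈ cartesianProduct (upTo (suc k₀)) (box ks) → quot x * den x ≡ N
  quot*den {m₀ , ms} x∈ with ∈-cartesianProduct⁻ (upTo (suc k₀)) (box ks) x∈
  ... | m₀∈ , ms∈ = trans
    -- The denominator lists φ(pᵐ) by `φ^`, while `period` applies the vector of exponent functions
    -- `es`; the two vectors agree by `zipWith-map₁`.
    (cong (λ v → quot (m₀ , ms) * lcms (λ2^ m₀ ∷ toList v)) (sym (zipWith-map₁ _$_ (λ p m → φ (p ^ m)) ps ms)))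
    (multiples*period ls pps′ uniq′ (k₀ ∷ ks) (∈-cartesianProductWith⁺ _∷_ m₀∈ ms∈))
  total : ∑ (cartesianProduct (upTo (suc k₀)) (box ks)) (λ x → num x * quot x) ≡ cycleCount ls pps′ uniq′ (k₀ ∷ ks)
  total = trans (∑-cartesianProductWith _,_ (upTo (suc k₀)) (box ks) (λ x → num x * quot x))
    (sym (∑-cartesianProductWith _∷_ (upTo (suc k₀)) (box ks) (λ ms → ∏ (φ^ (2 ∷ ps) ms) * multiples ls pps′ uniq′ (k₀ ∷ ks) ms)))
  cycleSum≡ : ∀ c → N * c ≡ cycleCount ls pps′ uniq′ (k₀ ∷ ks) → c ÷ 1 ≡ cycleSum k₀ ps ks
  cycleSum≡ c count = trans (÷-≡ {c} {N * c} {1} {N} (trans (*-comm c N) (sym (*-identityʳ (N * c)))))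
    (trans (cong (_÷ N) (trans count (sym total)))
      (sym (sumℚ-÷ num den quot N (cartesianProduct (upTo (suc k₀)) (box ks)) quot*den)))
  complement : ∀ c → c ≤ n → (n ∸ c) ÷ 1 ≡ n ÷ 1 - c ÷ 1
  complement c c≤n = begin
    (n ∸ c) ÷ 1                          ≡⟨ ℚ.+-identityʳ ((n ∸ c) ÷ 1) ⟨
    (n ∸ c) ÷ 1 +ℚ 0ℚ                    ≡⟨ cong ((n ∸ c) ÷ 1 +ℚ_) (ℚ.+-inverseʳ (c ÷ 1)) ⟨
    (n ∸ c) ÷ 1 +ℚ (c ÷ 1 - c ÷ 1)       ≡⟨ ℚ.+-assoc ((n ∸ c) ÷ 1) (c ÷ 1) (-ℚ (c ÷ 1)) ⟨
    ((n ∸ c) ÷ 1 +ℚ c ÷ 1) - c ÷ 1       ≡⟨ cong (_- c ÷ 1) (trans (÷-+ (n ∸ c) c 1) (cong (_÷ 1) (m∸n+n≡m c≤n))) ⟩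
    n ÷ 1 - c ÷ 1                        ∎
    where open ≡-Reasoning
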